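{- Let $s$ and $p\ge 2$ be positive integers. For every even (resp. odd) number $m$, the mapping $\phi_{(s+1,1)}$ (defined in the context) gives a one-to-one correspondence between the set of self-conjugate $(s,s+1,\dots,s+p)$-core partitions with $m$ corners and the set of paths in $F_D(s,p)$ (resp. $F_F(s,p)$) having exactly $\lfloor s/2\rfloor-m$ (resp. $\lfloor s/2\rfloor-m+1$) flat steps.
   Context: A partition is a finite (possibly empty) non-increasing sequence of positive integers, identified with its Young diagram. The number of corners of (the Young diagram of) a partition is its number of distinct part sizes. The hook length of a box is the number of boxes to its right in the same row plus the number of boxes below it in the same column plus $1$. A partition is an $s$-core if no box has hook length $s$, and an $(s_1,\dots,s_q)$-core if it is an $s_i$-core for every $i$. A partition is self-conjugate if its Young diagram is invariant under reflection in the main diagonal. $\mathcal{SC}_{(s_1,\dots,s_q)}$ is the set of self-conjugate $(s_1,\dots,s_q)$-core partitions. $MD(\lambda)$ is the set of hook lengths of the main diagonal boxes of $\lambda$; for self-conjugate $\lambda$ these are distinct odd numbers. $\mathcal{F}(m,t)$ is the set of lattice paths from $(0,0)$ to $(m,t)$ with up steps $U=(1,1)$, down steps $D=(1,-1)$ and flat steps $F=(1,0)$. Let $r=\lfloor s/2\rfloor$. The $(s+1,1;-2r-1)$-abacus diagram has rows indexed by $i\in\mathbb{Z}$ and columns indexed by $j\in\{0,1,\dots,r\}$; position $(i,j)$ has label $-(2r+1)+2(s+1)i+2j$. The abacus of a self-conjugate partition $\lambda$ is obtained by placing a bead on each position with label $\ell$ such that $|\ell|\in MD(\lambda)$; positions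 without a bead are spacers. For $\lambda\in\mathcal{SC}_{(s,s+1,s+2)}$, the abacus function $f:\{0,\dots,r\}\to\mathbb{Z}$ of $\lambda$ is: if some position in column $j$ with a positive label carries a bead, $f(j)$ is the largest $i$ such that $(i,j)$ carries a bead; otherwise $f(j)$ is the largest $i$ such that $(i,j)$ is a spacer with a negative label. Additionally set $f(r+1)=-1$. The map $\phi_{(s+1,1)}:\mathcal{SC}_{(s,s+1,s+2)}\to\mathcal{F}(r+1,-1)$ sends $\lambda$ to the path starting at $(0,0)$ whose $j$th step is $(1,f(j)-f(j-1))$, $j=1,\dots,r+1$. $F(s,p):=\phi_{(s+1,1)}(\mathcal{SC}_{(s,s+1,\dots,s+p)})$. Equivalently, $F(s,p)$ consists of the paths $P\in\mathcal{F}(\lfloor s/2\rfloor+1,-1)$ such that: (i) if $p\ge3$, $P$ has no $UF^iU$ as a consecutive subpath for $i=0,\dots,p-3$; (ii) $P$ does not start with $F^jU$ for $j=0,\dots,\lfloor (p-3)/2\rfloor$ if $s$ is even and $p\ge 3$, respectively for $j=0,\dots,\lfloor (p-4)/2\rfloor$ if $s$ is odd and $p\ge4$; (iii) $P$ does not end with $UF^k$ for $k=0,\dots,p-2$. For $A\in\{F,D\}$, $F_A(s,p)$ is the set of paths in $F(s,p)$ whose last step is $A$. -}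

module Defs where

open import Data.Fin.Base using (toℕ)
open import Data.Integer.Base as ℤ using (ℤ; +_; -[1+_]; ∣_∣; 0ℤ; 1ℤ; -1ℤ)
import Data.Integer.Properties as ℤₚ
open import Data.Integer.Tactic.RingSolver using (solve-∀)
open import Data.List.Base using (List; []; _∷_; length; filter; drop; deduplicate; applyUpTo)
import Data.List.Properties as Listₚ
open import Data.List.Relation.Unary.All using (All)
open import Data.List.Relation.Unary.Linked using (Linked)
open import Data.Nat.Base as ℕ using (ℕ; zero; suc; _∸_; _≤_; _<_; _≥_; ⌊_/2⌋; z≤n; s≤s)
open import Data.Nat.ListAction using (sum)
import Data.Nat.Properties as ℕₚ
open import Data.Product.Base using (∃; Σ-syntax; _×_; _,_)
open import Data.Sum.Base using (_⊎_; inj₁; inj₂)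
open import Data.Vec.Base using (Vec; tabulate; foldr′; count; last)
import Data.Vec.Relation.Unary.All as Vec
open import Function.Bundles using (_⇔_)
open import Level using (0ℓ)
open import Relation.Binary.PropositionalEquality using (_≡_; _≢_; refl; sym; trans; cong; cong₂; subst)
open import Relation.Nullary using (Dec; yes; no; ¬_; ¬?; contradiction)
open import Relation.Nullary.Decidable using (map′; _×-dec_)
open import Relation.Unary using (Pred; Decidable; _∈_)

record Partition : Set where
  constructor mkPartition
  field
    parts         : List ℕ
    nonIncreasing : Linked _≥_ parts
    positive      : All (0 <_) parts

open Partition public

entry : List ℕ → ℕ → ℕ
entry []       _       = 0
entry (x ∷ _)  zero    = x
entry (_ ∷ xs) (suc i) = entry xs i

row : Partition → ℕ → ℕ
row μ = entry (parts μ)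

-- (i , j) is the box in row i and column j, both counted from 0.
Box : Partition → ℕ → ℕ → Set
Box μ i j = j < row μ i

arm : Partition → ℕ → ℕ → ℕ
arm μ i j = row μ i ∸ suc j

leg : Partition → ℕ → ℕ → ℕ
leg μ i j = length (filter (j ℕₚ.<?_) (drop (suc i) (parts μ)))

-- Meaningful for boxes only.
hook : Partition → ℕ → ℕ → ℕ
hook μ i j = arm μ i j ℕ.+ leg μ i j ℕ.+ 1

corners : Partition → ℕ
corners μ = length (deduplicate ℕₚ._≟_ (parts μ))

IsCore : ℕ → Pred Partition 0ℓ
IsCore s μ = ∀ i j → Box μ i j → hook μ i j ≢ s

SelfConjugate : Pred Partition 0ℓ
SelfConjugate μ = ∀ i j → Box μ i j ⇔ Box μ j i

SC : List ℕ → Pred Partition 0ℓ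
SC ss μ = SelfConjugate μ × All (λ s → IsCore s μ) ss

interval : ℕ → ℕ → List ℕ
interval s p = applyUpTo (s ℕ.+_) (suc p)

MD : Partition → Pred ℕ 0ℓ
MD μ h = ∃ λ i → Box μ i i × hook μ i i ≡ h

-- Label of position (i,j) of the (s+1,1;-2r-1)-abacus, with r = ⌊ s /2⌋.
label : ℕ → ℤ → ℕ → ℤ
label s i j = ℤ.- (+ (2 ℕ.* ⌊ s /2⌋ ℕ.+ 1)) ℤ.+ + (2 ℕ.* (s ℕ.+ 1)) ℤ.* i ℤ.+ + (2 ℕ.* j)

Bead : ℕ → Partition → ℕ → ℤ → Set
Bead s μ j i = ∣ label s i j ∣ ∈ MD μ

Spacer : ℕ → Partition → ℕ → ℤ → Set
Spacer s μ j i = ¬ Bead s μ j i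

PositiveBead : ℕ → Partition → ℕ → ℤ → Set
PositiveBead s μ j i = 0ℤ ℤ.< label s i j × Bead s μ j i

NegativeSpacer : ℕ → Partition → ℕ → ℤ → Set
NegativeSpacer s μ j i = label s i j ℤ.< 0ℤ × Spacer s μ j i

Greatest : Pred ℤ 0ℓ → Pred ℤ 0ℓ
Greatest P i = P i × (∀ k → P k → k ℤ.≤ i)

IsAbacusValue : ℕ → Partition → ℕ → ℤ → Set
IsAbacusValue s μ j i =
  (∃ (PositiveBead s μ j) × Greatest (Bead s μ j) i)
  ⊎ (¬ ∃ (PositiveBead s μ j) × Greatest (NegativeSpacer s μ j) i)

-- Existence of the abacus values, for an arbitrary partition μ: the
-- hook lengths are bounded, so each search below is over a finite range.

private

  greatest : ∀ {P : Pred ℤ 0ℓ} → Decidable P → ∀ i n → P i →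
             (∀ k → P k → k ℤ.≤ i ℤ.+ + n) → ∃ (Greatest P)
  greatest P? i zero Pi ub = i , Pi , λ k Pk → subst (k ℤ.≤_) (ℤₚ.+-identityʳ i) (ub k Pk)
  greatest {P} P? i (suc n) Pi ub with P? (i ℤ.+ + suc n)
  ... | yes Pc = i ℤ.+ + suc n , Pc , ub
  ... | no ¬Pc = greatest P? i n Pi λ k Pk →
    subst (k ℤ.≤_) eq (ℤₚ.i<j⇒i≤pred[j] (ℤₚ.≤∧≢⇒< (ub k Pk) λ { refl → ¬Pc Pk }))
    where
    assoc : ∀ a b → -1ℤ ℤ.+ (a ℤ.+ (1ℤ ℤ.+ b)) ≡ a ℤ.+ b
    assoc = solve-∀
    eq : ℤ.pred (i ℤ.+ + suc n) ≡ i ℤ.+ + n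
    eq = assoc i (+ n)

  greatest-≤ : ∀ {P : Pred ℤ 0ℓ} → Decidable P → ∀ c → ∃ P →
               (∀ k → P k → k ℤ.≤ + c) → ∃ (Greatest P)
  greatest-≤ P? c (i , Pi) ub = greatest P? i ∣ + c ℤ.- i ∣ Pi λ k Pk →
    subst (k ℤ.≤_) eq (ub k Pk)
    where
    cancel : ∀ a b → a ≡ b ℤ.+ (a ℤ.- b)
    cancel = solve-∀
    eq : + c ≡ i ℤ.+ + ∣ + c ℤ.- i ∣
    eq = trans (cancel (+ c) i) (cong (λ z → i ℤ.+ z) (sym (ℤₚ.0≤i⇒+∣i∣≡i (ℤₚ.i≤j⇒0≤j-i (ub i Pi)))))

  entry>0⇒<length : ∀ xs i → 0 < entry xs i → i < length xs
  entry>0⇒<length (_ ∷ _)  zero    _ = s≤s z≤n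
  entry>0⇒<length (_ ∷ xs) (suc i) q = s≤s (entry>0⇒<length xs i q)

  entry≤sum : ∀ xs i → entry xs i ≤ sum xs
  entry≤sum []       _       = z≤n
  entry≤sum (x ∷ xs) zero    = ℕₚ.m≤m+n x (sum xs)
  entry≤sum (x ∷ xs) (suc i) = ℕₚ.≤-trans (entry≤sum xs i) (ℕₚ.m≤n+m (sum xs) x)

  hookBound : Partition → ℕ
  hookBound μ = sum (parts μ) ℕ.+ length (parts μ) ℕ.+ 1

  hook≤ : ∀ μ i j → hook μ i j ≤ hookBound μ
  hook≤ μ i j = ℕₚ.+-monoˡ-≤ 1 (ℕₚ.+-mono-≤
    (ℕₚ.≤-trans (ℕₚ.m∸n≤m (row μ i) (suc j)) (entry≤sum (parts μ) i))
    (ℕₚ.≤-trans (Listₚ.length-filter (j ℕₚ.<?_) (drop (suc i) (parts μ)))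
      (ℕₚ.≤-trans (ℕₚ.≤-reflexive (Listₚ.length-drop (suc i) (parts μ)))
        (ℕₚ.m∸n≤m (length (parts μ)) (suc i)))))

  MD-bound : ∀ μ {h} → h ∈ MD μ → h ≤ hookBound μ
  MD-bound μ (i , _ , refl) = hook≤ μ i i

MD? : ∀ μ → Decidable (MD μ)
MD? μ h = map′ (λ { (i , _ , q) → i , q })
               (λ { (i , b , e) → i , entry>0⇒<length (parts μ) i (ℕₚ.≤-<-trans z≤n b) , b , e })
               (ℕₚ.anyUpTo? (λ i → (i ℕₚ.<? row μ i) ×-dec (hook μ i i ℕₚ.≟ h)) (length (parts μ)))

module _ (s : ℕ) (μ : Partition) (j : ℕ) where

  private
    w r cap : ℕ
    w = 2 ℕ.* (s ℕ.+ 1)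
    r = ⌊ s /2⌋
    cap = hookBound μ ℕ.+ (2 ℕ.* r ℕ.+ 1)

    instance
      w≢0 : ℕ.NonZero w
      w≢0 = ℕ.>-nonZero (ℕₚ.≤-trans (ℕₚ.m≤n+m 1 s) (ℕₚ.m≤m+n (s ℕ.+ 1) _))

    bead? : Decidable (Bead s μ j)
    bead? i = MD? μ ∣ label s i j ∣

    unshift : ∀ i → + w ℤ.* i ℤ.+ + (2 ℕ.* j) ≡ label s i j ℤ.+ + (2 ℕ.* r ℕ.+ 1)
    unshift i = lem (+ (2 ℕ.* r ℕ.+ 1)) (+ w ℤ.* i) (+ (2 ℕ.* j))
      where
      lem : ∀ a b c → b ℤ.+ c ≡ ℤ.- a ℤ.+ b ℤ.+ c ℤ.+ a
      lem = solve-∀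

    -- In rows n ≥ 0 the absolute value of the label grows with n.
    row≤ : ∀ n → n ≤ ∣ label s (+ n) j ∣ ℕ.+ (2 ℕ.* r ℕ.+ 1)
    row≤ n = begin
      n                                               ≤⟨ ℕₚ.m≤n*m n w ⟩
      w ℕ.* n                                         ≤⟨ ℕₚ.m≤m+n (w ℕ.* n) (2 ℕ.* j) ⟩
      w ℕ.* n ℕ.+ 2 ℕ.* j                             ≡⟨ cong ∣_∣ (cong (ℤ._+ + (2 ℕ.* j)) (ℤₚ.pos-* w n)) ⟩
      ∣ + w ℤ.* + n ℤ.+ + (2 ℕ.* j) ∣                 ≡⟨ cong ∣_∣ (unshift (+ n)) ⟩
      ∣ label s (+ n) j ℤ.+ + (2 ℕ.* r ℕ.+ 1) ∣       ≤⟨ ℤₚ.∣i+j∣≤∣i∣+∣j∣ (label s (+ n) j) _ ⟩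
      ∣ label s (+ n) j ∣ ℕ.+ (2 ℕ.* r ℕ.+ 1)         ∎
      where open ℕₚ.≤-Reasoning

    bead≤cap : ∀ i → Bead s μ j i → i ℤ.≤ + cap
    bead≤cap (+ n)    b = ℤ.+≤+ (ℕₚ.≤-trans (row≤ n) (ℕₚ.+-monoˡ-≤ _ (MD-bound μ b)))
    bead≤cap -[1+ n ] b = ℤ.-≤+

    module _ (j≤r : j ≤ r) where

      excess : ℕ
      excess = 2 ℕ.* r ∸ 2 ℕ.* j

      label-neg : ∀ n → label s (ℤ.- (+ n)) j ≡ ℤ.- (+ (w ℕ.* n ℕ.+ excess ℕ.+ 1))
      label-neg n = trans
        (cong₂ (λ x y → ℤ.- (x ℤ.+ 1ℤ) ℤ.+ y ℤ.+ + (2 ℕ.* j)) split refl)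
        (trans (lem (+ excess) (+ (2 ℕ.* j)) (+ w) (+ n))
               (cong (λ x → ℤ.- (x ℤ.+ + excess ℤ.+ 1ℤ)) (sym (ℤₚ.pos-* w n))))
        where
        split : + (2 ℕ.* r) ≡ + excess ℤ.+ + (2 ℕ.* j)
        split = cong +_ (sym (ℕₚ.m∸n+n≡m (ℕₚ.*-monoʳ-≤ 2 j≤r)))
        lem : ∀ e c v m → ℤ.- (e ℤ.+ c ℤ.+ 1ℤ) ℤ.+ v ℤ.* (ℤ.- m) ℤ.+ c ≡ ℤ.- (v ℤ.* m ℤ.+ e ℤ.+ 1ℤ)
        lem = solve-∀

      negative : ∀ n → label s (ℤ.- (+ n)) j ℤ.< 0ℤ
      negative n = subst (ℤ._< 0ℤ)
        (sym (trans (label-neg n) (cong (λ x → ℤ.- (+ x)) (ℕₚ.+-comm _ 1)))) ℤ.-<+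

      farSpacer : NegativeSpacer s μ j (ℤ.- (+ hookBound μ))
      farSpacer = negative B , λ b → ℕₚ.<⇒≱ far (MD-bound μ b)
        where
        B = hookBound μ
        far : B < ∣ label s (ℤ.- (+ B)) j ∣
        far = begin-strict
          B                                         ≤⟨ ℕₚ.m≤n*m B w ⟩
          w ℕ.* B                                   ≤⟨ ℕₚ.m≤m+n (w ℕ.* B) excess ⟩
          w ℕ.* B ℕ.+ excess                        <⟨ ℕₚ.m<m+n _ (s≤s z≤n) ⟩
          w ℕ.* B ℕ.+ excess ℕ.+ 1                  ≡⟨ ℤₚ.∣-i∣≡∣i∣ (+ (w ℕ.* B ℕ.+ excess ℕ.+ 1)) ⟨
          ∣ ℤ.- (+ (w ℕ.* B ℕ.+ excess ℕ.+ 1)) ∣    ≡⟨ cong ∣_∣ (label-neg B) ⟨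
          ∣ label s (ℤ.- (+ B)) j ∣                 ∎
          where open ℕₚ.≤-Reasoning

      negativeSpacer≤ : ∀ i → NegativeSpacer s μ j i → i ℤ.≤ + (2 ℕ.* r ℕ.+ 1)
      negativeSpacer≤ (+ n) (l<0 , _) = begin
        + n                                        ≤⟨ ℤ.+≤+ (ℕₚ.m≤n*m n w) ⟩
        + (w ℕ.* n)                                ≤⟨ ℤ.+≤+ (ℕₚ.m≤m+n _ (2 ℕ.* j)) ⟩
        + (w ℕ.* n ℕ.+ 2 ℕ.* j)                    ≡⟨ cong (ℤ._+ + (2 ℕ.* j)) (ℤₚ.pos-* w n) ⟩
        + w ℤ.* + n ℤ.+ + (2 ℕ.* j)                ≡⟨ unshift (+ n) ⟩
        label s (+ n) j ℤ.+ + (2 ℕ.* r ℕ.+ 1)      ≤⟨ ℤₚ.+-monoˡ-≤ (+ (2 ℕ.* r ℕ.+ 1)) (ℤₚ.<⇒≤ l<0) ⟩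
        + (2 ℕ.* r ℕ.+ 1)                          ∎
        where open ℤₚ.≤-Reasoning
      negativeSpacer≤ -[1+ n ] _ = ℤ.-≤+

      positiveBead⇒ : ∀ i → PositiveBead s μ j i → ∃ λ n → n < suc cap × PositiveBead s μ j (+ n)
      positiveBead⇒ (+ n)    (0<l , b) = n , s≤s (ℤₚ.drop‿+≤+ (bead≤cap (+ n) b)) , 0<l , b
      positiveBead⇒ -[1+ n ] (0<l , _) = contradiction (negative (suc n)) (ℤₚ.<-asym 0<l)

      positiveBead? : Dec (∃ (PositiveBead s μ j))
      positiveBead? = map′ (λ { (n , _ , q) → + n , q }) (λ { (i , q) → positiveBead⇒ i q })
        (ℕₚ.anyUpTo? (λ n → (0ℤ ℤₚ.<? label s (+ n) j) ×-dec bead? (+ n)) (suc cap))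

  abacusValue : j ≤ ⌊ s /2⌋ → ∃ (IsAbacusValue s μ j)
  abacusValue j≤r with positiveBead? j≤r
  ... | yes pb@(i , _ , b) =
    let z , g = greatest-≤ bead? cap (i , b) bead≤cap in z , inj₁ (pb , g)
  ... | no ¬pb =
    let z , g = greatest-≤ (λ i → (label s i j ℤₚ.<? 0ℤ) ×-dec ¬? (bead? i))
                  (2 ℕ.* r ℕ.+ 1) (_ , farSpacer j≤r) (negativeSpacer≤ j≤r)
    in z , inj₂ (¬pb , g)

-- Only the values at j ≤ r + 1 matter; the last of these is f(r+1) = -1.
abacusFunction : ℕ → Partition → ℕ → ℤ
abacusFunction s μ j with j ℕₚ.≤? ⌊ s /2⌋
... | yes j≤r = let z , _ = abacusValue s μ j j≤r in z
... | no  _   = -1ℤ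

-- A path starting at (0,0) is the sequence of its steps; d stands for the
-- step (1,d).
Path : ℕ → Set
Path = Vec ℤ

U D F : ℤ
U = 1ℤ
D = -1ℤ
F = 0ℤ

height : ∀ {n} → Path n → ℤ
height = foldr′ ℤ._+_ 0ℤ

𝓕 : (m : ℕ) → ℤ → Pred (Path m) 0ℓ
𝓕 m t P = Vec.All (λ d → d ≡ U ⊎ d ≡ D ⊎ d ≡ F) P × height P ≡ t

flats : ∀ {n} → Path n → ℕ
flats = count (ℤₚ._≟ F)

-- φ_(s+1,1).  It is defined on all partitions; that it sends
-- self-conjugate (s,s+1,s+2)-cores into 𝓕(r+1,-1) is not part of the
-- definition.
φ : (s : ℕ) → Partition → Path (suc ⌊ s /2⌋)
φ s μ = tabulate λ k → abacusFunction s μ (suc (toℕ k)) ℤ.- abacusFunction s μ (toℕ k)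

-- The image of SC(s,…,s+p) under φ, as a set of paths in 𝓕(r+1,-1).
𝐅 : (s p : ℕ) → Pred (Path (suc ⌊ s /2⌋)) 0ℓ
𝐅 s p P = P ∈ 𝓕 (suc ⌊ s /2⌋) -1ℤ × Σ[ μ ∈ Partition ] μ ∈ SC (interval s p) × φ s μ ≡ P

𝐅[_] : ℤ → (s p : ℕ) → Pred (Path (suc ⌊ s /2⌋)) 0ℓ
𝐅[ A ] s p P = P ∈ 𝐅 s p × last P ≡ A

-- f restricts to a bijection from the subset X onto the subset Y.
BijectionBetween : {A B : Set} → (A → B) → Pred A 0ℓ → Pred B 0ℓ → Set
BijectionBetween f X Y =
  (∀ x → x ∈ X → f x ∈ Y)
  × (∀ x x′ → x ∈ X → x′ ∈ X → f x ≡ f x′ → x ≡ x′)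
  × (∀ y → y ∈ Y → ∃ λ x → x ∈ X × f x ≡ y)

{-# OPTIONS --safe #-}

-- Encode a partition by its Maya diagram, the set B of the integers
-- λ_i − i − 1 (rows i counted from 0).  For self-conjugate λ exactly one of
-- n, −1 − n lies in B, the nonnegative n ∈ B correspond to the diagonal hook
-- lengths 2 n + 1, and λ is a t-core only if B is closed under n ↦ n − t.
-- Hence f(j) is the largest row of column j whose place lies in B; the s- and
-- (s+2)-core conditions bound the steps of f, and f(0) = 0, f(r) ∈ {0, −1}.
-- Corners are the n ∈ B with n − 1 ∉ B, and n ↦ −n permutes them.  Each residue
-- class modulo s + 1 contains at most one of them: up to this symmetry one for
-- each up step of the path, and besides these only n = 0, which is a corner
-- exactly when f(r) = −1, i.e. when the last step is flat.  So with u up steps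
-- there are 2 u or 2 u + 1 corners, and the path has r − 2 u flat steps since
-- it has r + 1 steps and ends at height −1.
module Submission where

open import Defs
open import Algebra.Bundles using (AbelianGroup)
open import Data.Empty using (⊥; ⊥-elim)
open import Data.Fin.Base using (toℕ)
import Data.Fin.Properties as Finₚ
open import Data.Integer.Base as ℤ using (ℤ; +_; -[1+_]; 0ℤ; 1ℤ; -1ℤ; ∣_∣)
open import Data.Integer.DivMod using (_/ℕ_; _%ℕ_; n%ℕd<d; a≡a%ℕn+[a/ℕn]*n)
import Data.Integer.Properties as ℤₚ
open import Data.Integer.Tactic.RingSolver using (solve-∀)
open import Data.List.Base using (List; []; _∷_; _++_; length; filter; drop; map; upTo; applyUpTo; deduplicate)
open import Data.List.Membership.Propositional using () renaming (_∈_ to _∈ₗ_)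
open import Data.List.Membership.Propositional.Properties using
  (∈-∃++; ∈-++⁺ˡ; ∈-++⁺ʳ; ∈-++⁻; ∈-map⁺; ∈-map⁻; ∈-filter⁺; ∈-filter⁻; ∈-upTo⁺; ∈-upTo⁻; ∈-deduplicate⁺; ∈-deduplicate⁻)
import Data.List.Properties as Listₚ
open import Data.List.Relation.Unary.All as All using (All; []; _∷_)
open import Data.List.Relation.Unary.AllPairs using ([]; _∷_)
open import Data.List.Relation.Unary.Any using (here; there)
open import Data.List.Relation.Unary.Linked as Linked using (Linked; []; [-]; _∷_)
open import Data.List.Relation.Unary.Unique.Propositional using (Unique)
open import Data.List.Relation.Unary.Unique.Propositional.Properties using (++⁺; map⁺; filter⁺; upTo⁺)
open import Data.Nat.Base as ℕ using (ℕ; zero; suc; _∸_; _≤_; _<_; _≥_; ⌊_/2⌋; z≤n; s≤s)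
open import Data.Nat.Divisibility using (_∣_; _∤_; divides; ∣1⇒≡1; ∣m+n∣m⇒∣n)
import Data.Nat.Properties as ℕₚ
open import Data.Product.Base using (∃; _×_; _,_; proj₁; proj₂)
open import Data.Sum.Base as Sum using (_⊎_; inj₁; inj₂)
open import Data.Vec.Base using ([]; _∷_; tabulate; count; last)
import Data.Vec.Properties as Vecₚ
import Data.Vec.Relation.Unary.All as VecAll
import Data.Vec.Relation.Unary.All.Properties as VecAllₚ
open import Function.Base using (_∘_; id)
open import Function.Bundles using (_⇔_; mk⇔; Equivalence)
open import Level using (0ℓ)
open import Relation.Binary.Definitions using (tri<; tri≈; tri>)
open import Relation.Binary.PropositionalEquality
open import Relation.Nullary using (¬_; Dec; yes; no; contradiction)
open import Relation.Unary using (Pred; Decidable; _∈_)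

open import Algebra.Properties.Group (AbelianGroup.group ℤₚ.+-0-abelianGroup) using (∙-cancelˡ; ∙-cancelʳ)
open import Data.List.Relation.Unary.Unique.DecPropositional.Properties ℕₚ._≟_ using (deduplicate-!)

open Equivalence using (to; from)

-- The lemmas linear and absurd check certificates for linear arithmetic: the
-- conclusion is a sum of hypotheses, up to the slack k.
linear₁ : ∀ {a b c d} k → a ℤ.≤ b → d ℤ.- c ≡ b ℤ.- a ℤ.+ + k → c ℤ.≤ d
linear₁ k p e = ℤₚ.0≤i-j⇒j≤i (subst (0ℤ ℤ.≤_) (sym e) (ℤₚ.+-mono-≤ (ℤₚ.i≤j⇒0≤j-i p) (ℤ.+≤+ z≤n)))

linear₂ : ∀ {a b a′ b′ c d} k → a ℤ.≤ b → a′ ℤ.≤ b′ →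
          d ℤ.- c ≡ b ℤ.- a ℤ.+ (b′ ℤ.- a′) ℤ.+ + k → c ℤ.≤ d
linear₂ k p q e = ℤₚ.0≤i-j⇒j≤i (subst (0ℤ ℤ.≤_) (sym e)
  (ℤₚ.+-mono-≤ (ℤₚ.+-mono-≤ (ℤₚ.i≤j⇒0≤j-i p) (ℤₚ.i≤j⇒0≤j-i q)) (ℤ.+≤+ z≤n)))

absurd₁ : ∀ {a b} → a ℤ.≤ b → ∀ k → b ℤ.- a ≡ -[1+ k ] → ⊥
absurd₁ p k e with subst (0ℤ ℤ.≤_) e (ℤₚ.i≤j⇒0≤j-i p)
... | ()

absurd₂ : ∀ {a b a′ b′} → a ℤ.≤ b → a′ ℤ.≤ b′ → ∀ k → b ℤ.- a ℤ.+ (b′ ℤ.- a′) ≡ -[1+ k ] → ⊥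
absurd₂ p q k e with subst (0ℤ ℤ.≤_) e (ℤₚ.+-mono-≤ (ℤₚ.i≤j⇒0≤j-i p) (ℤₚ.i≤j⇒0≤j-i q))
... | ()

suc≤ : ∀ {a b} → a ℤ.< b → 1ℤ ℤ.+ a ℤ.≤ b
suc≤ = ℤₚ.i<j⇒suc[i]≤j

<suc : ∀ {a b} → 1ℤ ℤ.+ a ℤ.≤ b → a ℤ.< b
<suc = ℤₚ.suc[i]≤j⇒i<j

-- Entries of non-increasing lists and leg lengths.

entry-antitone : ∀ {xs} → Linked _≥_ xs → ∀ i → entry xs (suc i) ≤ entry xs i
entry-antitone []        i       = z≤n
entry-antitone [-]       i       = z≤n
entry-antitone (x≥y ∷ l) zero    = x≥y
entry-antitone (x≥y ∷ l) (suc i) = entry-antitone l i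

module _ (j : ℕ) where

  private
    tail⇔ : ∀ {x xs h} → (∀ i → j < entry (x ∷ xs) i ⇔ i < h) →
            ∀ i → j < entry xs i ⇔ i < h ∸ 1
    tail⇔ {h = zero}  eq i = mk⇔ (λ q → contradiction (to (eq (suc i)) q) ℕₚ.n≮0) λ ()
    tail⇔ {h = suc h} eq i = mk⇔ (λ q → ℕₚ.≤-pred (to (eq (suc i)) q))
                                 (λ q → from (eq (suc i)) (s≤s q))

  length-filter-> : ∀ xs h → (∀ i → j < entry xs i ⇔ i < h) → length (filter (j ℕₚ.<?_) xs) ≡ h
  length-filter-> [] zero eq = refl
  length-filter-> [] (suc h) eq = contradiction (from (eq 0) (s≤s z≤n)) ℕₚ.n≮0
  length-filter-> (x ∷ xs) zero eq = trans
    (cong length (Listₚ.filter-reject (j ℕₚ.<?_) λ j<x → ℕₚ.n≮0 (to (eq 0) j<x)))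
    (length-filter-> xs 0 (tail⇔ eq))
  length-filter-> (x ∷ xs) (suc h) eq = trans
    (cong length (Listₚ.filter-accept (j ℕₚ.<?_) (from (eq 0) (s≤s z≤n))))
    (cong suc (length-filter-> xs h (tail⇔ eq)))

  -- Evaluates legs: for `h = row μ j` the hypothesis is exactly self-conjugacy, so a leg becomes a
  -- truncated row length.
  length-filter->-drop : ∀ xs i h → (∀ i → j < entry xs i ⇔ i < h) →
                         length (filter (j ℕₚ.<?_) (drop i xs)) ≡ h ∸ i
  length-filter->-drop xs zero h eq = length-filter-> xs h eq
  length-filter->-drop [] (suc i) h eq = cong (_∸ suc i) (length-filter-> [] h eq)
  length-filter->-drop (x ∷ xs) (suc i) h eq =
    trans (length-filter->-drop xs i (h ∸ 1) (tail⇔ eq)) (ℕₚ.∸-+-assoc h 1 i)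

-- The Maya diagram of a partition.

-- Places are halved labels: n stands for the odd label 2 n + 1, so that hook
-- lengths are differences and conjugation is n ↦ −1 − n.
position : Partition → ℕ → ℤ
position μ i = + row μ i ℤ.- + suc i

Maya : Partition → ℤ → Set
Maya μ n = ∃ λ i → position μ i ≡ n

module _ (μ : Partition) where

  row-antitone : ∀ {i k} → i ≤ k → row μ k ≤ row μ i
  row-antitone i≤k = go (ℕₚ.≤⇒≤′ i≤k)
    where
    go : ∀ {i k} → i ℕ.≤′ k → row μ k ≤ row μ i
    go ℕ.≤′-refl     = ℕₚ.≤-refl
    go (ℕ.≤′-step q) = ℕₚ.≤-trans (entry-antitone (nonIncreasing μ) _) (go q)

  position-antitone : ∀ {i k} → i < k → position μ k ℤ.< position μ i
  position-antitone {i} {k} i<k =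
    <suc (linear₂ 0 (ℤ.+≤+ (row-antitone (ℕₚ.<⇒≤ i<k))) (ℤ.+≤+ i<k) (eq (+ row μ i) (+ row μ k) (+ i) (+ k)))
    where
    eq : ∀ a b i k → a ℤ.- (1ℤ ℤ.+ i) ℤ.- (1ℤ ℤ.+ (b ℤ.- (1ℤ ℤ.+ k))) ≡
                     a ℤ.- b ℤ.+ (k ℤ.- (1ℤ ℤ.+ i)) ℤ.+ 0ℤ
    eq = solve-∀

  position-cancel-< : ∀ {i k} → position μ k ℤ.< position μ i → i < k
  position-cancel-< {i} {k} q with ℕₚ.<-cmp i k
  ... | tri< p _ _ = p
  ... | tri≈ _ refl _ = contradiction q (ℤₚ.<-irrefl refl)
  ... | tri> _ _ p = contradiction q (ℤₚ.<-asym (position-antitone p))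

-- Pigeonhole counting and statistics of paths.

length-≤ : {A B : Set} (R : A → B → Set) → (∀ {x x′ y} → R x y → R x′ y → x ≡ x′) →
           ∀ {xs ys} → Unique xs → (∀ {x} → x ∈ₗ xs → ∃ λ y → y ∈ₗ ys × R x y) → length xs ≤ length ys
length-≤ R inj {[]} _ _ = z≤n
length-≤ R inj {x ∷ xs} (x∉ ∷ u) rel with rel (here refl)
... | y , y∈ , Rxy with ∈-∃++ y∈
-- The partner `y` of the head is cut out of `ys`; injectivity of `R` and uniqueness of `xs` keep
-- all other elements away from `y`.
...   | as , bs , refl = ℕₚ.≤-trans (s≤s (length-≤ R inj u rel′)) (ℕₚ.≤-reflexive (sym (Listₚ.length-++-sucʳ as y bs)))
  where
  rel′ : ∀ {z} → z ∈ₗ xs → ∃ λ y → y ∈ₗ as ++ bs × R z y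
  rel′ {z} z∈ with rel (there z∈)
  ... | v , v∈ , Rzv with ∈-++⁻ as v∈
  ...   | inj₁ p           = v , ∈-++⁺ˡ p , Rzv
  ...   | inj₂ (there p)   = v , ∈-++⁺ʳ as p , Rzv
  ...   | inj₂ (here refl) = contradiction (inj Rxy Rzv) (All.lookup x∉ z∈)

-- The recursion replaces the offset `h` by `h ∘ suc`; at `h = id` the list is `upTo n`.
count-tabulate : {A : Set} {P : Pred A 0ℓ} (P? : Decidable P) (g : ℕ → A) (h : ℕ → ℕ) → ∀ n →
  count P? (tabulate {n = n} (g ∘ h ∘ toℕ)) ≡ length (filter (P? ∘ g) (applyUpTo h n))
count-tabulate P? g h zero = refl
count-tabulate P? g h (suc n) with P? (g (h 0))
... | yes _ = cong suc (count-tabulate P? g (h ∘ suc) n)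
... | no _  = count-tabulate P? g (h ∘ suc) n

height-tabulate : ∀ (f : ℕ → ℤ) n →
  height (tabulate {n = n} λ k → f (suc (toℕ k)) ℤ.- f (toℕ k)) ≡ f n ℤ.- f 0
height-tabulate f zero    = sym (ℤₚ.+-inverseʳ (f 0))
height-tabulate f (suc n) = trans (cong (λ h → f 1 ℤ.- f 0 ℤ.+ h) (height-tabulate (f ∘ suc) n)) (eq (f 0) (f 1) (f (suc n)))
  where
  eq : ∀ a b c → b ℤ.- a ℤ.+ (c ℤ.- b) ≡ c ℤ.- a
  eq = solve-∀

last-tabulate : {A : Set} (g : ℕ → A) → ∀ n → last (tabulate {n = suc n} (g ∘ toℕ)) ≡ g n
last-tabulate g zero    = refl
last-tabulate g (suc n) = last-tabulate (g ∘ suc) n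

differences-injective : ∀ n {f g : ℕ → ℤ} → f 0 ≡ g 0 →
  tabulate {n = n} (λ k → f (suc (toℕ k)) ℤ.- f (toℕ k)) ≡ tabulate (λ k → g (suc (toℕ k)) ℤ.- g (toℕ k)) →
  ∀ j → j ≤ n → f j ≡ g j
differences-injective n       f₀≡g₀ e zero    _         = f₀≡g₀
differences-injective (suc n) {f} {g} f₀≡g₀ e (suc j) (s≤s j≤n) = differences-injective n {f ∘ suc} {g ∘ suc}
  (∙-cancelʳ (ℤ.- f 0) (f 1) (g 1) (trans (Vecₚ.∷-injectiveˡ e) (cong (λ x → g 1 ℤ.- x) (sym f₀≡g₀))))
  (Vecₚ.∷-injectiveʳ e) j j≤n

-- With u up, d down and e flat steps the length is u + d + e and the height u - d, so together they
-- make 2 u + e.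
flats-height : ∀ {n} {P : Path n} → VecAll.All (λ d → d ≡ U ⊎ d ≡ D ⊎ d ≡ F) P →
  + flats P ≡ + n ℤ.+ height P ℤ.- + (count (ℤₚ._≟ U) P ℕ.+ count (ℤₚ._≟ U) P)
flats-height VecAll.[] = refl
flats-height {suc n} {_ ∷ P} (inj₁ refl VecAll.∷ steps) =
  trans (flats-height steps) (trans (eq (+ n) (height P) (+ u)) (cong (λ x → 1ℤ ℤ.+ + n ℤ.+ (1ℤ ℤ.+ height P) ℤ.- + suc x) (sym (ℕₚ.+-suc u u))))
  where
  u = count (ℤₚ._≟ U) P
  eq : ∀ n h u → n ℤ.+ h ℤ.- (u ℤ.+ u) ≡ 1ℤ ℤ.+ n ℤ.+ (1ℤ ℤ.+ h) ℤ.- (1ℤ ℤ.+ (1ℤ ℤ.+ (u ℤ.+ u)))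
  eq = solve-∀
flats-height {suc n} {_ ∷ P} (inj₂ (inj₁ refl) VecAll.∷ steps) = trans (flats-height steps) (eq (+ n) (height P) (+ u))
  where
  u = count (ℤₚ._≟ U) P
  eq : ∀ n h u → n ℤ.+ h ℤ.- (u ℤ.+ u) ≡ 1ℤ ℤ.+ n ℤ.+ (-1ℤ ℤ.+ h) ℤ.- (u ℤ.+ u)
  eq = solve-∀
flats-height {suc n} {_ ∷ P} (inj₂ (inj₂ refl) VecAll.∷ steps) = trans (cong (λ x → 1ℤ ℤ.+ x) (flats-height steps)) (eq (+ n) (height P) (+ u))
  where
  u = count (ℤₚ._≟ U) P
  eq : ∀ n h u → 1ℤ ℤ.+ (n ℤ.+ h ℤ.- (u ℤ.+ u)) ≡ 1ℤ ℤ.+ n ℤ.+ (0ℤ ℤ.+ h) ℤ.- (u ℤ.+ u)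
  eq = solve-∀

-- Corners in terms of rows, and recovery of a partition from its Maya diagram.

entry-∈ : ∀ xs i → 0 < entry xs i → entry xs i ∈ₗ xs
entry-∈ (x ∷ xs) zero    _ = here refl
entry-∈ (x ∷ xs) (suc i) p = there (entry-∈ xs i p)

-- Picks from a block of equal parts the row that ends in a corner. Past the end of the list `entry`
-- is 0, so positivity makes the final row such a row.
last-occurrence : ∀ {xs d} → Linked _≥_ xs → All (0 <_) xs → d ∈ₗ xs →
                  ∃ λ i → entry xs i ≡ d × entry xs (suc i) < entry xs i
last-occurrence {_ ∷ []}     _         (0<x ∷ _) (here refl) = 0 , refl , 0<x
last-occurrence {x ∷ y ∷ xs} (x≥y ∷ l) (_ ∷ pos) (here refl) with ℕₚ.m≤n⇒m<n∨m≡n x≥y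
... | inj₁ y<x  = 0 , refl , y<x
... | inj₂ refl with last-occurrence l pos (here refl)
...   | i , e , q = suc i , e , q
last-occurrence {_ ∷ xs} l (_ ∷ pos) (there d∈) with last-occurrence (Linked.tail l) pos d∈
... | i , e , q = suc i , e , q

-- Positivity tells a further part from the default 0 past the end of a list.
entry-injective : ∀ {xs ys} → All (0 <_) xs → All (0 <_) ys → (∀ i → entry xs i ≡ entry ys i) → xs ≡ ys
entry-injective [] [] e = refl
entry-injective [] (0<y ∷ _) e = contradiction (e 0) (ℕₚ.<⇒≢ 0<y)
entry-injective (0<x ∷ _) [] e = contradiction (sym (e 0)) (ℕₚ.<⇒≢ 0<x)
entry-injective (_ ∷ xs) (_ ∷ ys) e = cong₂ _∷_ (e 0) (entry-injective xs ys (e ∘ suc))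

row-injective : ∀ {μ ν} → (∀ i → row μ i ≡ row ν i) → μ ≡ ν
row-injective {mkPartition xs l p} {mkPartition ys l′ p′} e with entry-injective p p′ e
... | refl = cong₂ (mkPartition xs) (Linked.irrelevant ℕₚ.≤-irrelevant l l′) (All.irrelevant ℕₚ.≤-irrelevant p p′)

module _ (μ ν : Partition) (sub : ∀ {n} → Maya μ n → Maya ν n) where

  private
    later : ∀ i → ∃ λ k → i ≤ k × position ν k ≡ position μ i
    later zero with sub (0 , refl)
    ... | k , e = k , z≤n , e
    later (suc i) with later i | sub (suc i , refl)
    ... | k , i≤k , e | l , e′ = l ,
      ℕₚ.≤-<-trans i≤k (position-cancel-< ν (subst₂ ℤ._<_ (sym e′) (sym e) (position-antitone μ (ℕₚ.n<1+n i)))) , e′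

  -- Places strictly decrease along the rows, so by induction the place of row i of `μ` is that of
  -- some row k ≥ i of `ν`. Hence row i of `μ` is shorter by k - i than row k of `ν`, which is no
  -- longer than row i of `ν`.
  Maya-⊆⇒row-≤ : ∀ i → row μ i ≤ row ν i
  Maya-⊆⇒row-≤ i with later i
  ... | k , i≤k , e = ℕₚ.≤-trans (ℤₚ.drop‿+≤+ (linear₂ 0 (ℤₚ.≤-reflexive (sym e)) (ℤ.+≤+ i≤k) (eq (+ row μ i) (+ row ν k) (+ i) (+ k))))
      (row-antitone ν i≤k)
    where
    eq : ∀ a b i k → b ℤ.- a ≡ b ℤ.- (1ℤ ℤ.+ k) ℤ.- (a ℤ.- (1ℤ ℤ.+ i)) ℤ.+ (k ℤ.- i) ℤ.+ 0ℤ
    eq = solve-∀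

Maya-injective : ∀ {μ ν} → (∀ {n} → Maya μ n ⇔ Maya ν n) → μ ≡ ν
Maya-injective {μ} {ν} e = row-injective λ i →
  ℕₚ.≤-antisym (Maya-⊆⇒row-≤ μ ν (to e) i) (Maya-⊆⇒row-≤ ν μ (from e) i)

module _ (μ : Partition) where

  -- A shorter next row has its place at least 2 lower, and the later places are lower still, so the
  -- value in between is skipped.
  corner-removable : ∀ {i} → row μ (suc i) < row μ i → ¬ Maya μ (position μ i ℤ.- 1ℤ)
  corner-removable {i} q (k , e) = ℤₚ.<⇒≱ (position-gap q) (subst (ℤ._≤ position μ (suc i)) e
      (position-≤ (position-cancel-< μ (subst (ℤ._< position μ i) (sym e) (<suc (ℤₚ.≤-reflexive (eq (position μ i))))))))
    where
    eq : ∀ p → 1ℤ ℤ.+ (p ℤ.- 1ℤ) ≡ p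
    eq = solve-∀
    eq′ : ∀ a b i → a ℤ.- (1ℤ ℤ.+ i) ℤ.- 1ℤ ℤ.- (1ℤ ℤ.+ (b ℤ.- (1ℤ ℤ.+ (1ℤ ℤ.+ i)))) ≡ a ℤ.- (1ℤ ℤ.+ b) ℤ.+ 0ℤ
    eq′ = solve-∀
    position-gap : row μ (suc i) < row μ i → position μ (suc i) ℤ.< position μ i ℤ.- 1ℤ
    position-gap q = <suc (linear₁ 0 (ℤ.+≤+ q) (eq′ (+ row μ i) (+ row μ (suc i)) (+ i)))
    position-≤ : ∀ {i k} → i < k → position μ k ℤ.≤ position μ (suc i)
    position-≤ i<k with ℕₚ.m≤n⇒m<n∨m≡n i<k
    ... | inj₁ p    = ℤₚ.<⇒≤ (position-antitone μ p)
    ... | inj₂ refl = ℤₚ.≤-refl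

  -- An equally long next row would have exactly the place one lower.
  removable-corner : ∀ {i} → ¬ Maya μ (position μ i ℤ.- 1ℤ) → row μ (suc i) < row μ i
  removable-corner {i} ¬m = ℕₚ.≤∧≢⇒< (row-antitone μ (ℕₚ.n≤1+n i)) λ e →
    ¬m (suc i , trans (cong (λ x → + x ℤ.- + suc (suc i)) e) (eq (+ row μ i) (+ i)))
    where
    eq : ∀ a i → a ℤ.- (1ℤ ℤ.+ (1ℤ ℤ.+ i)) ≡ a ℤ.- (1ℤ ℤ.+ i) ℤ.- 1ℤ
    eq = solve-∀

  corner-row-unique : ∀ {i k} → row μ (suc i) < row μ i → row μ (suc k) < row μ k → row μ i ≡ row μ k → i ≡ k
  corner-row-unique {i} {k} p q e = ℕₚ.≤-antisym (ℕₚ.≮⇒≥ (notBefore q (sym e))) (ℕₚ.≮⇒≥ (notBefore p e))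
    where
    notBefore : ∀ {i k} → row μ (suc i) < row μ i → row μ i ≡ row μ k → ¬ (i < k)
    notBefore p e i<k = ℕₚ.<⇒≱ p (subst (_≤ _) (sym e) (row-antitone μ i<k))

  position-injective : ∀ {i k} → position μ i ≡ position μ k → i ≡ k
  position-injective {i} {k} e = ℕₚ.≤-antisym
    (ℕₚ.≮⇒≥ λ k<i → ℤₚ.<-irrefl e (position-antitone μ k<i))
    (ℕₚ.≮⇒≥ λ i<k → ℤₚ.<-irrefl (sym e) (position-antitone μ i<k))

-- Parity, unit steps, and the places and labels of the abacus.

half-parity : ∀ n → n ≡ ⌊ n /2⌋ ℕ.+ ⌊ n /2⌋ ⊎ n ≡ suc (⌊ n /2⌋ ℕ.+ ⌊ n /2⌋)
half-parity zero = inj₁ refl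
half-parity (suc zero) = inj₂ refl
half-parity (suc (suc n)) with half-parity n
... | inj₁ e = inj₁ (cong suc (trans (cong suc e) (sym (ℕₚ.+-suc _ _))))
... | inj₂ e = inj₂ (cong suc (trans (cong suc e) (cong suc (sym (ℕₚ.+-suc _ _)))))

unit-step : ∀ {d} → -1ℤ ℤ.≤ d → d ℤ.≤ 1ℤ → d ≡ U ⊎ d ≡ D ⊎ d ≡ F
unit-step {+ 0} _ _ = inj₂ (inj₂ refl)
unit-step {+ 1} _ _ = inj₁ refl
unit-step {+ suc (suc _)} _ (ℤ.+≤+ (s≤s ()))
unit-step { -[1+ 0 ]} _ _ = inj₂ (inj₁ refl)
unit-step { -[1+ suc _ ]} (ℤ.-≤- ()) _

-- Row k and column j of the abacus, again with halved labels (see label-odd).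
place : ℕ → ℤ → ℕ → ℤ
place s k j = + suc s ℤ.* k ℤ.+ (+ j ℤ.- + suc ⌊ s /2⌋)

-- Let a be the residue of n + r + 1 modulo s + 1. If a ≤ r, then n lies in column a. Otherwise a ≤
-- s ≤ 2 r + 1, and the mirror image -1 - n lies in column 2 r + 1 - a ≤ r.
place-or-mirror : ∀ s n → (∃ λ k → ∃ λ j → j ≤ ⌊ s /2⌋ × n ≡ place s k j) ⊎
                          (∃ λ k → ∃ λ j → j ≤ ⌊ s /2⌋ × -1ℤ ℤ.- n ≡ place s k j)
place-or-mirror s n = go (a ℕₚ.≤? r)
  where
  r a : ℕ
  r = ⌊ s /2⌋
  a = (n ℤ.+ + suc r) %ℕ suc s
  w k : ℤ
  w = + suc s
  k = (n ℤ.+ + suc r) /ℕ suc s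
  a≤s : a ≤ s
  a≤s = ℕₚ.≤-pred (n%ℕd<d (n ℤ.+ + suc r) (suc s))
  a≤1+2r : a ≤ suc (r ℕ.+ r)
  a≤1+2r with half-parity s
  ... | inj₁ e = ℕₚ.m≤n⇒m≤1+n (subst (a ≤_) e a≤s)
  ... | inj₂ e = subst (a ≤_) e a≤s
  eq : ∀ n r → n ≡ n ℤ.+ r ℤ.- r
  eq = solve-∀
  eq′ : ∀ w a k r → a ℤ.+ k ℤ.* w ℤ.- r ≡ w ℤ.* k ℤ.+ (a ℤ.- r)
  eq′ = solve-∀
  n≡ : n ≡ place s k a
  n≡ = trans (eq n (+ suc r)) (trans (cong (ℤ._- + suc r) (a≡a%ℕn+[a/ℕn]*n (n ℤ.+ + suc r) (suc s))) (eq′ w (+ a) k (+ suc r)))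
  j : ℕ
  j = suc (r ℕ.+ r) ∸ a
  j+a : + j ℤ.+ + a ≡ 1ℤ ℤ.+ (+ r ℤ.+ + r)
  j+a = cong +_ (ℕₚ.m∸n+n≡m a≤1+2r)
  eq₁ : ∀ w k a r → -1ℤ ℤ.- (w ℤ.* k ℤ.+ (a ℤ.- (1ℤ ℤ.+ r))) ≡ w ℤ.* (ℤ.- k) ℤ.+ (1ℤ ℤ.+ (r ℤ.+ r) ℤ.- (a ℤ.+ (1ℤ ℤ.+ r)))
  eq₁ = solve-∀
  eq₂ : ∀ j a r → j ℤ.+ a ℤ.- (a ℤ.+ r) ≡ j ℤ.- r
  eq₂ = solve-∀
  mirror : -1ℤ ℤ.- n ≡ place s (ℤ.- k) j
  mirror = trans (cong (λ x → -1ℤ ℤ.- x) n≡) (trans (eq₁ w k (+ a) (+ r))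
    (cong (λ x → w ℤ.* (ℤ.- k) ℤ.+ x)
      (trans (cong (ℤ._- (+ a ℤ.+ + suc r)) (sym j+a)) (eq₂ (+ j) (+ a) (+ suc r)))))
  go : Dec (a ≤ r) → _
  go (yes a≤r) = inj₁ (k , a , a≤r , n≡)
  go (no a≰r)  = inj₂ (ℤ.- k , j , ℕₚ.m≤n+o⇒m∸n≤o (suc (r ℕ.+ r)) a (ℕₚ.+-monoˡ-≤ r (ℕₚ.≰⇒> a≰r)) , mirror)

odd : ℤ → ℤ
odd n = 1ℤ ℤ.+ + 2 ℤ.* n

odd-sign : ∀ n → (0ℤ ℤ.≤ n × 0ℤ ℤ.< odd n) ⊎ (n ℤ.< 0ℤ × odd n ℤ.< 0ℤ)
odd-sign n with 0ℤ ℤₚ.≤? n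
... | yes p = inj₁ (p , <suc (linear₂ 0 p p (eq n)))
  where
  eq : ∀ n → 1ℤ ℤ.+ + 2 ℤ.* n ℤ.- (1ℤ ℤ.+ 0ℤ) ≡ n ℤ.- 0ℤ ℤ.+ (n ℤ.- 0ℤ) ℤ.+ 0ℤ
  eq = solve-∀
... | no p = inj₂ (ℤₚ.≰⇒> p , <suc (linear₂ 0 (suc≤ (ℤₚ.≰⇒> p)) (suc≤ (ℤₚ.≰⇒> p)) (eq n)))
  where
  eq : ∀ n → 0ℤ ℤ.- (1ℤ ℤ.+ (1ℤ ℤ.+ + 2 ℤ.* n)) ≡ 0ℤ ℤ.- (1ℤ ℤ.+ n) ℤ.+ (0ℤ ℤ.- (1ℤ ℤ.+ n)) ℤ.+ 0ℤ
  eq = solve-∀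

label-odd : ∀ s k j → label s k j ≡ odd (place s k j)
label-odd s k j = trans
  (cong₂ (λ x y → ℤ.- x ℤ.+ y ℤ.* k ℤ.+ + (2 ℕ.* j)) (cong (ℤ._+ 1ℤ) (ℤₚ.pos-* 2 r)) (ℤₚ.pos-* 2 (s ℕ.+ 1)))
  (trans (cong (λ x → ℤ.- (+ 2 ℤ.* + r ℤ.+ 1ℤ) ℤ.+ + 2 ℤ.* (+ s ℤ.+ 1ℤ) ℤ.* k ℤ.+ x) (ℤₚ.pos-* 2 j))
    (eq (+ s) (+ r) k (+ j)))
  where
  r = ⌊ s /2⌋
  eq : ∀ s r k j → ℤ.- (+ 2 ℤ.* r ℤ.+ 1ℤ) ℤ.+ + 2 ℤ.* (s ℤ.+ 1ℤ) ℤ.* k ℤ.+ + 2 ℤ.* j ≡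
                   1ℤ ℤ.+ + 2 ℤ.* ((1ℤ ℤ.+ s) ℤ.* k ℤ.+ (j ℤ.- (1ℤ ℤ.+ r)))
  eq = solve-∀

abacusFunction-value : ∀ s μ {j} → j ≤ ⌊ s /2⌋ → IsAbacusValue s μ j (abacusFunction s μ j)
abacusFunction-value s μ {j} j≤r with j ℕₚ.≤? ⌊ s /2⌋
... | yes p = proj₂ (abacusValue s μ j p)
... | no ¬p = contradiction j≤r ¬p

abacusFunction-last : ∀ s μ → abacusFunction s μ (suc ⌊ s /2⌋) ≡ -1ℤ
abacusFunction-last s μ with suc ⌊ s /2⌋ ℕₚ.≤? ⌊ s /2⌋
... | yes p = contradiction p ℕₚ.1+n≰n
... | no _  = refl

-- The Maya diagram of a self-conjugate partition.

module SelfConj (μ : Partition) (sc : SelfConjugate μ) where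

  noBox : ∀ {i j} → row μ i ≤ j → row μ j ≤ i
  noBox {i} {j} p = ℕₚ.≮⇒≥ λ q → ℕₚ.<⇒≱ (to (sc j i) q) p

  -- Column j is as long as row j, so the leg is `row μ j` minus i + 1; regrouping arm and leg gives
  -- the two places.
  hook-position : ∀ {i j} → Box μ i j → + hook μ i j ≡ position μ i ℤ.+ position μ j ℤ.+ 1ℤ
  hook-position {i} {j} b = begin
    + (arm μ i j ℕ.+ leg μ i j ℕ.+ 1)
      ≡⟨ cong (λ x → + (arm μ i j ℕ.+ x ℕ.+ 1)) (length-filter->-drop j (parts μ) (suc i) (row μ j) (λ k → sc k j)) ⟩
    + arm μ i j ℤ.+ + (row μ j ∸ suc i) ℤ.+ 1ℤ
      ≡⟨ eq (+ arm μ i j) (+ (row μ j ∸ suc i)) (+ i) (+ j) ⟩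
    + suc j ℤ.+ + arm μ i j ℤ.- + suc i ℤ.+ (+ suc i ℤ.+ + (row μ j ∸ suc i) ℤ.- + suc j) ℤ.+ 1ℤ
      ≡⟨ cong₂ (λ x y → + x ℤ.- + suc i ℤ.+ (+ y ℤ.- + suc j) ℤ.+ 1ℤ)
               (ℕₚ.m+[n∸m]≡n b) (ℕₚ.m+[n∸m]≡n (to (sc i j) b)) ⟩
    position μ i ℤ.+ position μ j ℤ.+ 1ℤ ∎
    where
    open ≡-Reasoning
    eq : ∀ a b i j → a ℤ.+ b ℤ.+ 1ℤ ≡ 1ℤ ℤ.+ j ℤ.+ a ℤ.- (1ℤ ℤ.+ i) ℤ.+ (1ℤ ℤ.+ i ℤ.+ b ℤ.- (1ℤ ℤ.+ j)) ℤ.+ 1ℤ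
    eq = solve-∀

  -- By symmetry `row μ i` exceeds j exactly when `row μ j` exceeds i. So the two places add up to
  -- at least 0 on a box and to at most -2 off the diagram.
  box⇔ : ∀ {i j} → Box μ i j ⇔ 0ℤ ℤ.≤ position μ i ℤ.+ position μ j
  box⇔ {i} {j} = mk⇔
    (λ b → linear₂ 0 (ℤ.+≤+ b) (ℤ.+≤+ (to (sc i j) b)) (eq (+ row μ i) (+ row μ j) (+ i) (+ j)))
    (λ p → ℕₚ.≰⇒> λ q → absurd₂ p (ℤₚ.+-mono-≤ (ℤ.+≤+ q) (ℤ.+≤+ (noBox q))) 1 (eq′ (+ row μ i) (+ row μ j) (+ i) (+ j)))
    where
    eq : ∀ a b i j → a ℤ.- (1ℤ ℤ.+ i) ℤ.+ (b ℤ.- (1ℤ ℤ.+ j)) ℤ.- 0ℤ ≡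
                     a ℤ.- (1ℤ ℤ.+ j) ℤ.+ (b ℤ.- (1ℤ ℤ.+ i)) ℤ.+ 0ℤ
    eq = solve-∀
    eq′ : ∀ a b i j → a ℤ.- (1ℤ ℤ.+ i) ℤ.+ (b ℤ.- (1ℤ ℤ.+ j)) ℤ.- 0ℤ ℤ.+ (j ℤ.+ i ℤ.- (a ℤ.+ b)) ≡ -[1+ 1 ]
    eq′ = solve-∀

  -- Two mirror places would add up to -1, which falls into the gap between the sums off the diagram
  -- and the sums on it.
  Maya-exclusive : ∀ {n} → Maya μ n → ¬ Maya μ (-1ℤ ℤ.- n)
  Maya-exclusive (i , refl) (j , e) = -1≱0 (subst (0ℤ ℤ.≤_) sum (to (box⇔ {i} {j}) box))
    where
    -1≱0 : ¬ (0ℤ ℤ.≤ -1ℤ)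
    -1≱0 ()
    eq : ∀ x → x ℤ.+ (-1ℤ ℤ.- x) ≡ -1ℤ
    eq = solve-∀
    sum : position μ i ℤ.+ position μ j ≡ -1ℤ
    sum = trans (cong (λ x → position μ i ℤ.+ x) e) (eq (position μ i))
    eq′ : ∀ a b i j → a ℤ.- (1ℤ ℤ.+ i) ℤ.+ (b ℤ.- (1ℤ ℤ.+ j)) ℤ.- -1ℤ ℤ.+ (j ℤ.+ i ℤ.- (a ℤ.+ b)) ≡ -1ℤ
    eq′ = solve-∀
    box : Box μ i j
    box = ℕₚ.≰⇒> λ q → absurd₂ (ℤₚ.≤-reflexive (sym sum))
      (ℤₚ.+-mono-≤ (ℤ.+≤+ q) (ℤ.+≤+ (noBox {i} q))) 0 (eq′ (+ row μ i) (+ row μ j) (+ i) (+ j))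

  private
    firstBelow : ∀ n i → position μ i ℤ.≤ n →
                 ∃ λ k → position μ k ℤ.≤ n × (∀ l → k ≡ suc l → n ℤ.< position μ l)
    firstBelow n zero p = zero , p , λ _ ()
    firstBelow n (suc i) p with position μ i ℤₚ.≤? n
    ... | yes q = firstBelow n i q
    ... | no q  = suc i , p , λ { _ refl → ℤₚ.≰⇒> q }

    someBelow : ∀ n → ∃ λ i → position μ i ℤ.≤ n
    someBelow n = i , linear₂ 1 (ℤ.+≤+ (row-antitone μ {0} {i} z≤n)) (below n) (eq (+ row μ 0) (+ row μ i) (+ ∣ n ∣) n)
      where
      -- Row i is no longer than row 0, so its place is below -∣n∣.
      i = row μ 0 ℕ.+ ∣ n ∣
      below : ∀ n → ℤ.- (+ ∣ n ∣) ℤ.≤ n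
      below (+ zero)  = ℤ.+≤+ z≤n
      below (+ suc n) = ℤ.-≤+
      below -[1+ n ]  = ℤₚ.≤-refl
      eq : ∀ a b c n → n ℤ.- (b ℤ.- (1ℤ ℤ.+ (a ℤ.+ c))) ≡ a ℤ.- b ℤ.+ (n ℤ.- (ℤ.- c)) ℤ.+ 1ℤ
      eq = solve-∀

  -- Let i be the first row with place at most n. If that place is not n itself, column n + i meets
  -- exactly the i rows above row i. By self-conjugacy row n + i then has length i, and its place is
  -- -1 - n.
  Maya-total : ∀ n → Maya μ n ⊎ Maya μ (-1ℤ ℤ.- n)
  Maya-total n with firstBelow n _ (proj₂ (someBelow n))
  ... | i , below , above with position μ i ℤₚ.≟ n
  ...   | yes e = inj₁ (i , e)
  ...   | no ne = inj₂ (j , trans (cong (λ x → + x ℤ.- + suc j) row-j) (trans (cong (λ x → + i ℤ.- (1ℤ ℤ.+ x)) j≡) (eq₄ n (+ i))))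
    where
    n+i≥0 : 0ℤ ℤ.≤ n ℤ.+ + i
    n+i≥0 = linear₂ 0 (suc≤ (ℤₚ.≤∧≢⇒< below ne)) (ℤ.+≤+ (z≤n {row μ i})) (eq₁ n (+ row μ i) (+ i))
      where
      eq₁ : ∀ n a i → n ℤ.+ i ℤ.- 0ℤ ≡ n ℤ.- (1ℤ ℤ.+ (a ℤ.- (1ℤ ℤ.+ i))) ℤ.+ (a ℤ.- 0ℤ) ℤ.+ 0ℤ
      eq₁ = solve-∀
    j = ∣ n ℤ.+ + i ∣
    j≡ : + j ≡ n ℤ.+ + i
    j≡ = ℤₚ.0≤i⇒+∣i∣≡i n+i≥0
    eq₂ : ∀ n a i → n ℤ.+ i ℤ.- a ≡ n ℤ.- (1ℤ ℤ.+ (a ℤ.- (1ℤ ℤ.+ i))) ℤ.+ 0ℤ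
    eq₂ = solve-∀
    eq₃ : ∀ n a l → a ℤ.- (1ℤ ℤ.+ (n ℤ.+ (1ℤ ℤ.+ l))) ≡ a ℤ.- (1ℤ ℤ.+ l) ℤ.- (1ℤ ℤ.+ n) ℤ.+ 0ℤ
    eq₃ = solve-∀
    eq₄ : ∀ n i → i ℤ.- (1ℤ ℤ.+ (n ℤ.+ i)) ≡ -1ℤ ℤ.- n
    eq₄ = solve-∀
    row-i≤j : row μ i ≤ j
    row-i≤j = ℤₚ.drop‿+≤+ (subst (+ row μ i ℤ.≤_) (sym j≡) (linear₁ 0 (suc≤ (ℤₚ.≤∧≢⇒< below ne)) (eq₂ n (+ row μ i) (+ i))))
    boxes : ∀ k → i ≡ suc k → k < row μ j
    boxes k refl = to (sc k j) (ℤₚ.drop‿+<+ (subst (ℤ._< + row μ k) (sym j≡)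
      (<suc (linear₁ 0 (suc≤ (above k refl)) (eq₃ n (+ row μ k) (+ k))))))
    row-j≥ : ∀ k → i ≡ k → k ≤ row μ j
    row-j≥ zero _ = z≤n
    row-j≥ (suc k) e = boxes k e
    row-j : row μ j ≡ i
    row-j = ℕₚ.≤-antisym (noBox row-i≤j) (row-j≥ i refl)

  -- If n - t were missing, its mirror image would be the place of a row j. This place and n add up
  -- to t - 1 ≥ 0, so (i , j) would be a box with hook length t.
  core-closed : ∀ {t} → IsCore t μ → 1 ≤ t → ∀ {n} → Maya μ n → Maya μ (n ℤ.- + t)
  core-closed {t} core 1≤t {n} (i , n≡) = Sum.[ id , (λ (j , e) → ⊥-elim (core i j (box j e) (hook≡t j e))) ]′
                                            (Maya-total (n ℤ.- + t))
    where
    eq : ∀ n t → n ℤ.+ (-1ℤ ℤ.- (n ℤ.- t)) ≡ t ℤ.- 1ℤ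
    eq = solve-∀
    eq′ : ∀ t → t ℤ.- 1ℤ ℤ.+ 1ℤ ≡ t
    eq′ = solve-∀
    sum : ∀ j → position μ j ≡ -1ℤ ℤ.- (n ℤ.- + t) → position μ i ℤ.+ position μ j ≡ + t ℤ.- 1ℤ
    sum j e = trans (cong₂ ℤ._+_ n≡ e) (eq n (+ t))
    box : ∀ j → position μ j ≡ -1ℤ ℤ.- (n ℤ.- + t) → Box μ i j
    box j e = from box⇔ (subst (0ℤ ℤ.≤_) (sym (sum j e)) (ℤₚ.i≤j⇒0≤j-i (ℤ.+≤+ 1≤t)))
    hook≡t : ∀ j → position μ j ≡ -1ℤ ℤ.- (n ℤ.- + t) → hook μ i j ≡ t
    hook≡t j e = ℤₚ.+-injective (trans (hook-position (box j e)) (trans (cong (ℤ._+ 1ℤ) (sum j e)) (eq′ (+ t))))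

  complement : ∀ {n} → ¬ Maya μ n → Maya μ (-1ℤ ℤ.- n)
  complement {n} ¬b = Sum.[ (λ b → ⊥-elim (¬b b)) , id ]′ (Maya-total n)

  -- A row with place p meets the diagonal exactly when 2 p ≥ 0, and its diagonal hook length is
  -- then 2 p + 1.
  MD⇔Maya : ∀ {n} → 0ℤ ℤ.≤ n → MD μ ∣ odd n ∣ ⇔ Maya μ n
  MD⇔Maya {n} 0≤n = mk⇔
    (λ { (i , b , e) → i , ℤₚ.*-cancelˡ-≡ (+ 2) _ _ (∙-cancelˡ 1ℤ _ _
      (trans (eq (position μ i)) (trans (sym (hook-position b)) (trans (cong +_ e) abs)))) })
    (λ { (i , refl) → let b = from box⇔ (ℤₚ.+-mono-≤ 0≤n 0≤n) in
      i , b , ℤₚ.+-injective (trans (hook-position b) (trans (sym (eq (position μ i))) (sym abs))) })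
    where
    abs : + ∣ odd n ∣ ≡ odd n
    abs with odd-sign n
    ... | inj₁ (_ , p) = ℤₚ.0≤i⇒+∣i∣≡i (ℤₚ.<⇒≤ p)
    ... | inj₂ (n<0 , _) = contradiction 0≤n (ℤₚ.<⇒≱ n<0)
    eq : ∀ p → 1ℤ ℤ.+ + 2 ℤ.* p ≡ p ℤ.+ p ℤ.+ 1ℤ
    eq = solve-∀

  -- The absolute value turns the label of n into that of the nonnegative mirror place -1 - n, and
  -- of the two exactly one is in the diagram.
  MD⇔¬Maya : ∀ {n} → n ℤ.< 0ℤ → MD μ ∣ odd n ∣ ⇔ (¬ Maya μ n)
  MD⇔¬Maya {n} n<0 = mk⇔
    (λ h b → Maya-exclusive b (to (MD⇔Maya 0≤-1-n) (subst (MD μ) abs h)))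
    (λ ¬b → subst (MD μ) (sym abs) (from (MD⇔Maya 0≤-1-n) (complement ¬b)))
    where
    eq : ∀ n → -1ℤ ℤ.- n ℤ.- 0ℤ ≡ 0ℤ ℤ.- (1ℤ ℤ.+ n) ℤ.+ 0ℤ
    eq = solve-∀
    0≤-1-n : 0ℤ ℤ.≤ -1ℤ ℤ.- n
    0≤-1-n = linear₁ 0 (suc≤ n<0) (eq n)
    eq′ : ∀ n → ℤ.- (1ℤ ℤ.+ + 2 ℤ.* n) ≡ 1ℤ ℤ.+ + 2 ℤ.* (-1ℤ ℤ.- n)
    eq′ = solve-∀
    abs : ∣ odd n ∣ ≡ ∣ odd (-1ℤ ℤ.- n) ∣
    abs = trans (sym (ℤₚ.∣-i∣≡∣i∣ (odd n))) (cong ∣_∣ (eq′ n))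

  -- Beads, spacers and the top of a column.

  module _ (s : ℕ) where

    -- Labels are odd, hence never 0. The diagram consists of the beads with positive label and the
    -- spacers with negative label, which unites the two cases of `IsAbacusValue`.
    label-sign : ∀ k j → (0ℤ ℤ.< label s k j × (Bead s μ j k ⇔ Maya μ (place s k j))) ⊎
                         (label s k j ℤ.< 0ℤ × (Bead s μ j k ⇔ (¬ Maya μ (place s k j))))
    label-sign k j with odd-sign (place s k j)
    ... | inj₁ (0≤ , 0<)  = inj₁ (subst (0ℤ ℤ.<_) (sym (label-odd s k j)) 0< ,
            subst (λ l → MD μ ∣ l ∣ ⇔ Maya μ (place s k j)) (sym (label-odd s k j)) (MD⇔Maya 0≤))
    ... | inj₂ (n<0 , <0) = inj₂ (subst (ℤ._< 0ℤ) (sym (label-odd s k j)) <0 ,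
            subst (λ l → MD μ ∣ l ∣ ⇔ (¬ Maya μ (place s k j))) (sym (label-odd s k j)) (MD⇔¬Maya n<0))

    label-mono : ∀ {k k′} j → k ℤ.≤ k′ → label s k j ℤ.≤ label s k′ j
    label-mono j k≤k′ = ℤₚ.+-monoˡ-≤ (+ (2 ℕ.* j)) (ℤₚ.+-monoʳ-≤ (ℤ.- (+ (2 ℕ.* ⌊ s /2⌋ ℕ.+ 1)))
      (ℤₚ.*-monoˡ-≤-nonNeg (+ (2 ℕ.* (s ℕ.+ 1))) k≤k′))

    -- `Maya-total` decides between n and its mirror image, which removes the double negation.
    Maya-stable : ∀ {P : Set} n → P ⇔ (¬ Maya μ n) → ¬ P → Maya μ n
    Maya-stable n e ¬p = Sum.[ id , (λ b → ⊥-elim (¬p (from e λ b′ → Maya-exclusive {n} b′ b))) ]′ (Maya-total n)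

    label-negative-below : ∀ {i k} j → k ℤ.≤ i → 0ℤ ℤ.< label s k j → ¬ (label s i j ℤ.< 0ℤ)
    label-negative-below {i} {k} j k≤i 0<l l<0 = ℤₚ.<-asym {0ℤ} {label s i j}
      (ℤₚ.<-≤-trans {0ℤ} {label s k j} {label s i j} 0<l (label-mono {k} {i} j k≤i)) l<0

    bead-Maya : ∀ {i j k} → k ℤ.≤ i → 0ℤ ℤ.< label s k j → Bead s μ j i → Maya μ (place s i j)
    bead-Maya {i} {j} {k} k≤i 0<l b = Sum.[ (λ (_ , e) → to e b)
      , (λ (l<0 , _) → ⊥-elim (label-negative-below {i} {k} j k≤i 0<l l<0)) ]′ (label-sign i j)

    spacer-Maya : ∀ {i j} → NegativeSpacer s μ j i → Maya μ (place s i j)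
    spacer-Maya {i} {j} (l<0 , spacer) = Sum.[ above , below ]′ (label-sign i j)
      where
      above : (0ℤ ℤ.< label s i j × (Bead s μ j i ⇔ Maya μ (place s i j))) → Maya μ (place s i j)
      above (0<l , _) = ⊥-elim (ℤₚ.<-asym {label s i j} {0ℤ} l<0 0<l)
      below : (label s i j ℤ.< 0ℤ × (Bead s μ j i ⇔ (¬ Maya μ (place s i j)))) → Maya μ (place s i j)
      below (_ , e) = Maya-stable (place s i j) e spacer

    top-Maya : ∀ {j i} → IsAbacusValue s μ j i → Maya μ (place s i j)
    top-Maya {j} {i} (inj₁ ((k , 0<l , b) , b′ , max)) = bead-Maya {i} {j} {k} (max k b) 0<l b′
    top-Maya {j} {i} (inj₂ (_ , sp , _)) = spacer-Maya {i} {j} sp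

    top-max : ∀ {j i} → IsAbacusValue s μ j i → ∀ k → Maya μ (place s k j) → k ℤ.≤ i
    top-max {j} v k b with label-sign k j
    top-max (inj₁ (_ , _ , max)) k b | inj₁ (_ , e) = max k (from e b)
    -- A row with negative label is below the positive bead in row k′, and that bead is not above
    -- the greatest one.
    top-max {j} {i} (inj₁ ((k′ , 0<l , b′) , _ , max)) k b | inj₂ (l<0 , _) = ℤₚ.≮⇒≥ λ i<k →
      ℤₚ.<-asym l<0 (ℤₚ.<-≤-trans 0<l (label-mono j (ℤₚ.≤-trans (max k′ b′) (ℤₚ.<⇒≤ i<k))))
    top-max (inj₂ (none , _)) k b | inj₁ (0<l , e) = contradiction (k , 0<l , from e b) none
    top-max (inj₂ (_ , _ , max)) k b | inj₂ (l<0 , e) = max k (l<0 , λ h → to e h b)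

-- Diagrams of self-conjugate (s, s + 1, s + 2)-cores, detached from partitions.

record CoreDiagram (s : ℕ) (B : ℤ → Set) : Set where
  field
    exclusive : ∀ {n} → B n → ¬ B (-1ℤ ℤ.- n)
    total     : ∀ n → B n ⊎ B (-1ℤ ℤ.- n)
    closed₀   : ∀ {n} → B n → B (n ℤ.- + s)
    closed₁   : ∀ {n} → B n → B (n ℤ.- + suc s)
    closed₂   : ∀ {n} → B n → B (n ℤ.- + suc (suc s))

module Diagram {s : ℕ} {B : ℤ → Set} (diagram : CoreDiagram s B) where

  open CoreDiagram diagram

  r : ℕ
  r = ⌊ s /2⌋

  w : ℤ
  w = + suc s

  -- These n correspond to the corners of the partition.
  Removable : ℤ → Set
  Removable n = B n × ¬ B (n ℤ.- 1ℤ)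

  ¬B⇒B : ∀ {n} → ¬ B n → B (-1ℤ ℤ.- n)
  ¬B⇒B {n} ¬b with total n
  ... | inj₁ b = contradiction b ¬b
  ... | inj₂ b = b

  -- Mirroring exchanges the two conditions: -n is the mirror image of n - 1, and -n - 1 that of n.
  Removable-neg : ∀ {n} → Removable n → Removable (ℤ.- n)
  Removable-neg {n} (b , ¬b) = subst B (eq n) (¬B⇒B ¬b) , λ b′ → exclusive b (subst B (eq′ n) b′)
    where
    eq : ∀ n → -1ℤ ℤ.- (n ℤ.- 1ℤ) ≡ ℤ.- n
    eq = solve-∀
    eq′ : ∀ n → ℤ.- n ℤ.- 1ℤ ≡ -1ℤ ℤ.- n
    eq′ = solve-∀

  closed-multiple : ∀ m {n} → B n → B (n ℤ.- w ℤ.* + m)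
  closed-multiple zero {n} b = subst B (eq w n) b
    where
    eq : ∀ w n → n ≡ n ℤ.- w ℤ.* 0ℤ
    eq = solve-∀
  closed-multiple (suc m) {n} b = subst B (eq w n (+ m)) (closed-multiple m (closed₁ b))
    where
    eq : ∀ w n m → n ℤ.- w ℤ.- w ℤ.* m ≡ n ℤ.- w ℤ.* (1ℤ ℤ.+ m)
    eq = solve-∀

  closed-below : ∀ {k k′ e} → k′ ℤ.≤ k → B (w ℤ.* k ℤ.+ e) → B (w ℤ.* k′ ℤ.+ e)
  closed-below {k} {k′} {e} p b = subst B (trans (cong (λ x → w ℤ.* k ℤ.+ e ℤ.- w ℤ.* x) (ℤₚ.0≤i⇒+∣i∣≡i (ℤₚ.i≤j⇒0≤j-i p))) (eq w k k′ e))
    (closed-multiple ∣ k ℤ.- k′ ∣ b)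
    where
    eq : ∀ w k k′ e → w ℤ.* k ℤ.+ e ℤ.- w ℤ.* (k ℤ.- k′) ≡ w ℤ.* k′ ℤ.+ e
    eq = solve-∀

  private
    -- Subtracting s + 2 from the upper place gives a place one less in offset and one row lower.
    -- Closure under s + 1 takes it down to row k, to the very place that must be missing.
    Removable-¬< : ∀ {k k′ e} → Removable (w ℤ.* k ℤ.+ e) → Removable (w ℤ.* k′ ℤ.+ e) → ¬ (k ℤ.< k′)
    Removable-¬< {k} {k′} {e} p q k<k′ = proj₂ p (subst B (eq w k e)
      (closed-below {ℤ.pred k′} {k} (ℤₚ.i<j⇒i≤pred[j] k<k′) (subst B (eq′ (+ s) k′ e) (closed₂ (proj₁ q)))))
      where
      eq : ∀ w k e → w ℤ.* k ℤ.+ (e ℤ.- 1ℤ) ≡ w ℤ.* k ℤ.+ e ℤ.- 1ℤ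
      eq = solve-∀
      eq′ : ∀ s k e → (1ℤ ℤ.+ s) ℤ.* k ℤ.+ e ℤ.- (1ℤ ℤ.+ (1ℤ ℤ.+ s)) ≡ (1ℤ ℤ.+ s) ℤ.* (-1ℤ ℤ.+ k) ℤ.+ (e ℤ.- 1ℤ)
      eq′ = solve-∀

  Removable-unique : ∀ {k k′ e} → Removable (w ℤ.* k ℤ.+ e) → Removable (w ℤ.* k′ ℤ.+ e) → k ≡ k′
  Removable-unique {k} {k′} p q with ℤₚ.<-cmp k k′
  ... | tri< k<k′ _ _ = contradiction k<k′ (Removable-¬< p q)
  ... | tri≈ _ k≡k′ _ = k≡k′
  ... | tri> _ _ k′<k = contradiction k′<k (Removable-¬< q p)

  r+r≤s : r ℕ.+ r ≤ s
  r+r≤s with half-parity s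
  ... | inj₁ e = ℕₚ.≤-reflexive (sym e)
  ... | inj₂ e = ℕₚ.≤-trans (ℕₚ.n≤1+n _) (ℕₚ.≤-reflexive (sym e))

  -- Two offsets of absolute value at most r differ by at most 2 r ≤ s, hence by no nonzero multiple
  -- of s + 1.
  column-unique : ∀ {k k′ e e′} → ∣ e ∣ ≤ r → ∣ e′ ∣ ≤ r → w ℤ.* k ℤ.+ e ≡ w ℤ.* k′ ℤ.+ e′ → e ≡ e′
  column-unique {k} {k′} {e} {e′} |e|≤r |e′|≤r q with ∣ k ℤ.- k′ ∣ in |k-k′|
  ... | zero = ∙-cancelˡ (w ℤ.* k) e e′
        (trans q (cong (λ x → w ℤ.* x ℤ.+ e′) (sym (ℤₚ.i-j≡0⇒i≡j k k′ (ℤₚ.∣i∣≡0⇒i≡0 |k-k′|)))))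
  ... | suc d = contradiction r+r≤s (ℕₚ.<⇒≱ (begin-strict
    s                              <⟨ ℕₚ.n<1+n s ⟩
    suc s                          ≤⟨ ℕₚ.m≤m*n (suc s) (suc d) ⟩
    suc s ℕ.* suc d                ≡⟨ cong (suc s ℕ.*_) |k-k′| ⟨
    suc s ℕ.* ∣ k ℤ.- k′ ∣         ≡⟨ ℤₚ.∣i*j∣≡∣i∣*∣j∣ w (k ℤ.- k′) ⟨
    ∣ w ℤ.* (k ℤ.- k′) ∣           ≡⟨ cong ∣_∣ difference ⟩
    ∣ e′ ℤ.- e ∣                   ≤⟨ ℤₚ.∣i-j∣≤∣i∣+∣j∣ e′ e ⟩
    ∣ e′ ∣ ℕ.+ ∣ e ∣               ≤⟨ ℕₚ.+-mono-≤ |e′|≤r |e|≤r ⟩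
    r ℕ.+ r                        ∎))
    where
    open ℕₚ.≤-Reasoning
    eq : ∀ w k k′ e → w ℤ.* (k ℤ.- k′) ≡ w ℤ.* k ℤ.+ e ℤ.- (w ℤ.* k′ ℤ.+ e)
    eq = solve-∀
    eq′ : ∀ w k′ e e′ → w ℤ.* k′ ℤ.+ e′ ℤ.- (w ℤ.* k′ ℤ.+ e) ≡ e′ ℤ.- e
    eq′ = solve-∀
    difference : w ℤ.* (k ℤ.- k′) ≡ e′ ℤ.- e
    difference = trans (eq w k k′ e) (trans (cong (λ x → x ℤ.- (w ℤ.* k′ ℤ.+ e)) q) (eq′ w k′ e e′))

  private
    to-even : ∀ s r → s ≡ r ℤ.+ r → r ℤ.- (1ℤ ℤ.+ s) ≡ -1ℤ ℤ.- r
    to-even _ r refl = eq r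
      where
      eq : ∀ r → r ℤ.- (1ℤ ℤ.+ (r ℤ.+ r)) ≡ -1ℤ ℤ.- r
      eq = solve-∀

    to-odd : ∀ s r → s ≡ 1ℤ ℤ.+ (r ℤ.+ r) → r ℤ.- s ≡ -1ℤ ℤ.- r
    to-odd _ r refl = eq r
      where
      eq : ∀ r → r ℤ.- (1ℤ ℤ.+ (r ℤ.+ r)) ≡ -1ℤ ℤ.- r
      eq = solve-∀

    to-even′ : ∀ s r → s ≡ r ℤ.+ r → s ℤ.- r ℤ.- (1ℤ ℤ.+ s) ≡ -1ℤ ℤ.- (s ℤ.- r)
    to-even′ _ r refl = eq r
      where
      eq : ∀ r → r ℤ.+ r ℤ.- r ℤ.- (1ℤ ℤ.+ (r ℤ.+ r)) ≡ -1ℤ ℤ.- (r ℤ.+ r ℤ.- r)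
      eq = solve-∀

    to-odd′ : ∀ s r → s ≡ 1ℤ ℤ.+ (r ℤ.+ r) → s ℤ.- r ℤ.- (1ℤ ℤ.+ (1ℤ ℤ.+ s)) ≡ -1ℤ ℤ.- (s ℤ.- r)
    to-odd′ _ r refl = eq r
      where
      eq : ∀ r → 1ℤ ℤ.+ (r ℤ.+ r) ℤ.- r ℤ.- (1ℤ ℤ.+ (1ℤ ℤ.+ (1ℤ ℤ.+ (r ℤ.+ r)))) ≡ -1ℤ ℤ.- (1ℤ ℤ.+ (r ℤ.+ r) ℤ.- r)
      eq = solve-∀

  -- If instead r is in `B`, subtracting 2 r + 1, which is s + 1 for even s and s for odd s, leads
  -- to -1 - r all the same.
  B[-1-r] : B (-1ℤ ℤ.- + r)
  B[-1-r] with total (+ r) | half-parity s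
  ... | inj₂ b | _      = b
  ... | inj₁ b | inj₁ e = subst B (to-even (+ s) (+ r) (cong +_ e)) (closed₁ b)
  ... | inj₁ b | inj₂ e = subst B (to-odd (+ s) (+ r) (cong +_ e)) (closed₀ b)

  -- The distance 2 (s - r) + 1 to the mirror image is s + 1 for even s and s + 2 for odd s, so
  -- closure would put both mirror images into `B`.
  ¬B[s-r] : ¬ B (+ s ℤ.- + r)
  ¬B[s-r] b with half-parity s
  ... | inj₁ e = exclusive b (subst B (to-even′ (+ s) (+ r) (cong +_ e)) (closed₁ b))
  ... | inj₂ e = exclusive b (subst B (to-odd′ (+ s) (+ r) (cong +_ e)) (closed₂ b))

  -- The abacus function: bounds on its steps and its boundary values.

  module AbacusFunction
    (f : ℕ → ℤ)
    (top : ∀ {j} → j ≤ r → ∀ k → k ℤ.≤ f j ⇔ B (place s k j))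
    (f-last : f (suc r) ≡ -1ℤ)
    where

    -- Subtracting s + 2 moves one row down and one column to the left.
    ascent : ∀ {j} → j < r → f (suc j) ℤ.- f j ℤ.≤ 1ℤ
    ascent {j} j<r = linear₁ 0 (from (top (ℕₚ.<⇒≤ j<r) _) (subst B (eq (+ s) (f (suc j)) (+ j) (+ suc r))
        (closed₂ (to (top j<r _) (ℤₚ.≤-refl {f (suc j)}))))) (eq′ (f j) (f (suc j)))
      where
      eq : ∀ s k j r → (1ℤ ℤ.+ s) ℤ.* k ℤ.+ (1ℤ ℤ.+ j ℤ.- r) ℤ.- (1ℤ ℤ.+ (1ℤ ℤ.+ s)) ≡
                       (1ℤ ℤ.+ s) ℤ.* (k ℤ.- 1ℤ) ℤ.+ (j ℤ.- r)
      eq = solve-∀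
      eq′ : ∀ a b → 1ℤ ℤ.- (b ℤ.- a) ≡ a ℤ.- (b ℤ.- 1ℤ) ℤ.+ 0ℤ
      eq′ = solve-∀

    -- Subtracting s moves one row down and one column to the right.
    descent : ∀ {j} → j < r → -1ℤ ℤ.≤ f (suc j) ℤ.- f j
    descent {j} j<r = linear₁ 0 (from (top j<r _) (subst B (eq (+ s) (f j) (+ j) (+ suc r))
        (closed₀ (to (top (ℕₚ.<⇒≤ j<r) _) (ℤₚ.≤-refl {f j}))))) (eq′ (f j) (f (suc j)))
      where
      eq : ∀ s k j r → (1ℤ ℤ.+ s) ℤ.* k ℤ.+ (j ℤ.- r) ℤ.- s ≡
                       (1ℤ ℤ.+ s) ℤ.* (k ℤ.- 1ℤ) ℤ.+ (1ℤ ℤ.+ j ℤ.- r)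
      eq = solve-∀
      eq′ : ∀ a b → b ℤ.- a ℤ.- -1ℤ ≡ b ℤ.- (a ℤ.- 1ℤ) ℤ.+ 0ℤ
      eq′ = solve-∀

    below-top : ∀ {j} → j ≤ r → ∀ {k} → ¬ B (place s (1ℤ ℤ.+ k) j) → f j ℤ.≤ k
    below-top {j} j≤r {k} ¬b = linear₁ 0 (suc≤ (ℤₚ.≰⇒> λ p → ¬b (to (top j≤r (1ℤ ℤ.+ k)) p))) (eq (f j) k)
      where
      eq : ∀ a k → k ℤ.- a ≡ 1ℤ ℤ.+ k ℤ.- (1ℤ ℤ.+ a) ℤ.+ 0ℤ
      eq = solve-∀

    f-first : f 0 ≡ 0ℤ
    f-first = ℤₚ.≤-antisym
      -- Rows 1 and 0 of column 0 are the places s - r and -1 - r.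
      (below-top z≤n {0ℤ} λ b → ¬B[s-r] (subst B (eq (+ s) (+ r)) b))
      (from (top z≤n 0ℤ) (subst B (eq′ w (+ r)) B[-1-r]))
      where
      eq : ∀ s r → (1ℤ ℤ.+ s) ℤ.* 1ℤ ℤ.+ (0ℤ ℤ.- (1ℤ ℤ.+ r)) ≡ s ℤ.- r
      eq = solve-∀
      eq′ : ∀ w r → -1ℤ ℤ.- r ≡ w ℤ.* 0ℤ ℤ.+ (0ℤ ℤ.- (1ℤ ℤ.+ r))
      eq′ = solve-∀

    -- Row 0 of column r is the place -1 and row 1 is the place s; from s, closure under s would
    -- reach 0, the mirror image of -1.
    f-r≡0 : B -1ℤ → f r ≡ 0ℤ
    f-r≡0 b₋₁ = ℤₚ.≤-antisym
      (below-top ℕₚ.≤-refl {0ℤ} λ b → exclusive b₋₁ (subst B (eq (+ s) (+ r)) (closed₀ b)))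
      (from (top ℕₚ.≤-refl 0ℤ) (subst B (eq′ w (+ r)) b₋₁))
      where
      eq : ∀ s r → (1ℤ ℤ.+ s) ℤ.* 1ℤ ℤ.+ (r ℤ.- (1ℤ ℤ.+ r)) ℤ.- s ≡ 0ℤ
      eq = solve-∀
      eq′ : ∀ w r → -1ℤ ≡ w ℤ.* 0ℤ ℤ.+ (r ℤ.- (1ℤ ℤ.+ r))
      eq′ = solve-∀

    -- Row 0 of column r is -1, the mirror image of 0, and row -1 is 0 - (s + 2).
    f-r≡-1 : B 0ℤ → f r ≡ -1ℤ
    f-r≡-1 b₀ = ℤₚ.≤-antisym
      (below-top ℕₚ.≤-refl { -1ℤ} λ b → exclusive b₀ (subst B (eq w (+ r)) b))
      (from (top ℕₚ.≤-refl -1ℤ) (subst B (eq′ (+ s) (+ r)) (closed₂ b₀)))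
      where
      eq : ∀ w r → w ℤ.* 0ℤ ℤ.+ (r ℤ.- (1ℤ ℤ.+ r)) ≡ -1ℤ
      eq = solve-∀
      eq′ : ∀ s r → 0ℤ ℤ.- (1ℤ ℤ.+ (1ℤ ℤ.+ s)) ≡ (1ℤ ℤ.+ s) ℤ.* -1ℤ ℤ.+ (r ℤ.- (1ℤ ℤ.+ r))
      eq′ = solve-∀

    last-step : ℤ
    last-step = f (suc r) ℤ.- f r

    last-cases : (B 0ℤ × f r ≡ -1ℤ × last-step ≡ F) ⊎ (¬ B 0ℤ × f r ≡ 0ℤ × last-step ≡ D)
    last-cases with total 0ℤ
    ... | inj₁ b = inj₁ (b , f-r≡-1 b , cong₂ ℤ._-_ f-last (f-r≡-1 b))
    ... | inj₂ b = inj₂ ((λ b′ → exclusive b′ b) , f-r≡0 b , cong₂ ℤ._-_ f-last (f-r≡0 b))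

    step : ∀ {j} → j ≤ r → f (suc j) ℤ.- f j ≡ U ⊎ f (suc j) ℤ.- f j ≡ D ⊎ f (suc j) ℤ.- f j ≡ F
    step {j} j≤r with ℕₚ.m≤n⇒m<n∨m≡n j≤r | last-cases
    ... | inj₁ j<r  | _                    = unit-step (descent j<r) (ascent j<r)
    ... | inj₂ refl | inj₁ (_ , _ , flat)  = inj₂ (inj₂ flat)
    ... | inj₂ refl | inj₂ (_ , _ , down)  = inj₂ (inj₁ down)

    -- Up steps and the residue classes of removable places.

    Ascends : ℕ → Set
    Ascends j = f (suc j) ℤ.- f j ≡ U

    ascends? : ∀ j → Dec (Ascends j)
    ascends? j = f (suc j) ℤ.- f j ℤₚ.≟ U

    ups : List ℕ
    ups = filter ascends? (upTo (suc r))

    ∈-ups⁻ : ∀ {j} → j ∈ₗ ups → j < r × Ascends j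
    ∈-ups⁻ {j} j∈ with ∈-filter⁻ ascends? {xs = upTo (suc r)} j∈
    ... | j∈ , up with ℕₚ.m≤n⇒m<n∨m≡n (ℕₚ.≤-pred (∈-upTo⁻ j∈)) | last-cases
    ...   | inj₁ j<r  | _ = j<r , up
    ...   | inj₂ refl | inj₁ (_ , _ , flat) = contradiction (trans (sym up) flat) λ ()
    ...   | inj₂ refl | inj₂ (_ , _ , down) = contradiction (trans (sym up) down) λ ()

    -- The top place of column j + 1, lessened by 1, is in the same row of column j, whose top is
    -- one row lower.
    ups-removable : ∀ {j} → j ∈ₗ ups → Removable (w ℤ.* f (suc j) ℤ.+ (+ j ℤ.- + r))
    ups-removable {j} j∈ with ∈-ups⁻ j∈
    ... | j<r , up = subst B (eq w (f (suc j)) (+ j) (+ r)) (to (top j<r _) (ℤₚ.≤-refl {f (suc j)})) ,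
      λ b → absurd₁ (from (top (ℕₚ.<⇒≤ j<r) (f (suc j))) (subst B (eq′ w (f (suc j)) (+ j) (+ r)) b)) 0
              (trans (eq″ (f (suc j)) (f j)) (cong ℤ.-_ up))
      where
      eq : ∀ w k j r → w ℤ.* k ℤ.+ (1ℤ ℤ.+ j ℤ.- (1ℤ ℤ.+ r)) ≡ w ℤ.* k ℤ.+ (j ℤ.- r)
      eq = solve-∀
      eq′ : ∀ w k j r → w ℤ.* k ℤ.+ (j ℤ.- r) ℤ.- 1ℤ ≡ w ℤ.* k ℤ.+ (j ℤ.- (1ℤ ℤ.+ r))
      eq′ = solve-∀
      eq″ : ∀ a b → b ℤ.- a ≡ ℤ.- (a ℤ.- b)
      eq″ = solve-∀

    -- Row k is filled in column j + 1 but not in column j, so f rises, and by `ascent` it rises by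
    -- exactly 1.
    removable-ups : ∀ {j k} → j < r → Removable (w ℤ.* k ℤ.+ (+ j ℤ.- + r)) → j ∈ₗ ups
    removable-ups {j} {k} j<r (b , ¬b) =
      ∈-filter⁺ ascends? (∈-upTo⁺ (ℕₚ.m<n⇒m<1+n j<r)) (ℤₚ.≤-antisym (ascent j<r)
        (linear₂ 0 (from (top j<r k) (subst B (eq w k (+ j) (+ r)) b))
          (suc≤ (ℤₚ.≰⇒> λ p → ¬b (subst B (eq′ w k (+ j) (+ r)) (to (top (ℕₚ.<⇒≤ j<r) k) p))))
          (eq″ k (f j) (f (suc j)))))
      where
      eq : ∀ w k j r → w ℤ.* k ℤ.+ (j ℤ.- r) ≡ w ℤ.* k ℤ.+ (1ℤ ℤ.+ j ℤ.- (1ℤ ℤ.+ r))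
      eq = solve-∀
      eq′ : ∀ w k j r → w ℤ.* k ℤ.+ (j ℤ.- (1ℤ ℤ.+ r)) ≡ w ℤ.* k ℤ.+ (j ℤ.- r) ℤ.- 1ℤ
      eq′ = solve-∀
      eq″ : ∀ k a b → b ℤ.- a ℤ.- 1ℤ ≡ b ℤ.- k ℤ.+ (k ℤ.- (1ℤ ℤ.+ a)) ℤ.+ 0ℤ
      eq″ = solve-∀

    left right : ℕ → ℤ
    left j  = + j ℤ.- + r
    right j = + r ℤ.- + j

    -- Given the form of a predicate on residues so that `middle` is the list of 0 alone or empty,
    -- according to `f r`.
    middle? : ∀ (e : ℤ) → Dec (f r ≡ -1ℤ)
    middle? _ = f r ℤₚ.≟ -1ℤ

    middle columns : List ℤ
    middle  = filter middle? (0ℤ ∷ [])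
    columns = map left ups ++ map right ups ++ middle

    private
      -left : ∀ j → ℤ.- left j ≡ right j
      -left j = eq (+ j) (+ r)
        where
        eq : ∀ j r → ℤ.- (j ℤ.- r) ≡ r ℤ.- j
        eq = solve-∀

      ∣right∣ : ∀ {j} → j ≤ r → ∣ right j ∣ ≤ r
      ∣right∣ {j} j≤r = subst (_≤ r) (sym (trans (cong ∣_∣ (ℤₚ.[+m]-[+n]≡m⊖n r j)) (cong ∣_∣ (ℤₚ.⊖-≥ j≤r)))) (ℕₚ.m∸n≤m r j)

      0<right : ∀ {j} → j < r → 0ℤ ℤ.< right j
      0<right {j} j<r = subst (0ℤ ℤ.<_) (sym (trans (ℤₚ.[+m]-[+n]≡m⊖n r j) (ℤₚ.⊖-≥ (ℕₚ.<⇒≤ j<r)))) (ℤ.+<+ (ℕₚ.m<n⇒0<n∸m j<r))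

      left<0 : ∀ {j} → j < r → left j ℤ.< 0ℤ
      left<0 {j} j<r = subst (ℤ._< 0ℤ) (eq (+ j) (+ r)) (ℤₚ.neg-mono-< (0<right j<r))
        where
        eq : ∀ j r → ℤ.- (r ℤ.- j) ≡ j ℤ.- r
        eq = solve-∀

      Removable-flip : ∀ k e → Removable (w ℤ.* k ℤ.+ e) → Removable (w ℤ.* (ℤ.- k) ℤ.+ ℤ.- e)
      Removable-flip k e p = subst Removable (eq w k e) (Removable-neg p)
        where
        eq : ∀ w k e → ℤ.- (w ℤ.* k ℤ.+ e) ≡ w ℤ.* (ℤ.- k) ℤ.+ ℤ.- e
        eq = solve-∀

    -- The residues e modulo s + 1 in the symmetric range |e| ≤ r whose class
    -- contains a removable bead.
    data Column : ℤ → Set where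
      leftColumn   : ∀ {j} → j ∈ₗ ups → Column (left j)
      rightColumn  : ∀ {j} → j ∈ₗ ups → Column (right j)
      middleColumn : f r ≡ -1ℤ → Column 0ℤ

    ∈-columns⁻ : ∀ {e} → e ∈ₗ columns → Column e
    ∈-columns⁻ e∈ with ∈-++⁻ (map left ups) e∈
    ... | inj₁ p with ∈-map⁻ left p
    ...   | _ , j∈ , refl = leftColumn j∈
    ∈-columns⁻ e∈ | inj₂ p with ∈-++⁻ (map right ups) p
    ...   | inj₁ q with ∈-map⁻ right q
    ...     | _ , j∈ , refl = rightColumn j∈
    ∈-columns⁻ e∈ | inj₂ p | inj₂ q with ∈-filter⁻ middle? {xs = 0ℤ ∷ []} q
    ...     | here refl , fr = middleColumn fr

    ∈-columns⁺ : ∀ {e} → Column e → e ∈ₗ columns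
    ∈-columns⁺ (leftColumn j∈)   = ∈-++⁺ˡ (∈-map⁺ left j∈)
    ∈-columns⁺ (rightColumn j∈)  = ∈-++⁺ʳ (map left ups) (∈-++⁺ˡ (∈-map⁺ right j∈))
    ∈-columns⁺ (middleColumn fr) = ∈-++⁺ʳ (map left ups) (∈-++⁺ʳ (map right ups)
      (∈-filter⁺ middle? (here refl) fr))

    -- The three parts are disjoint by sign: up steps have j < r, so left residues are negative and
    -- right ones positive.
    columns-! : Unique columns
    columns-! = ++⁺ (map⁺ (λ {x} {y} → left-injective {x} {y}) ups-!)
      (++⁺ (map⁺ (λ {x} {y} → right-injective {x} {y}) ups-!) (filter⁺ middle? ([] ∷ []))
        λ { (p , q) → right≢middle p q })
      λ { (p , q) → left≢rest p q }
      where
      ups-! : Unique ups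
      ups-! = filter⁺ ascends? (upTo⁺ (suc r))
      left-injective : ∀ {i j} → left i ≡ left j → i ≡ j
      left-injective {i} {j} e = ℤₚ.+-injective (∙-cancelʳ (ℤ.- (+ r)) (+ i) (+ j) e)
      right-injective : ∀ {i j} → right i ≡ right j → i ≡ j
      right-injective {i} {j} e = ℤₚ.+-injective (ℤₚ.neg-injective (∙-cancelˡ (+ r) (ℤ.- (+ i)) (ℤ.- (+ j)) e))
      right-positive : ∀ {e} → e ∈ₗ map right ups → 0ℤ ℤ.< e
      right-positive e∈ with ∈-map⁻ right e∈
      ... | _ , j∈ , refl = 0<right (proj₁ (∈-ups⁻ j∈))
      middle-zero : ∀ {e} → e ∈ₗ middle → e ≡ 0ℤ
      middle-zero e∈ with ∈-filter⁻ middle? {xs = 0ℤ ∷ []} e∈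
      ... | here refl , _ = refl
      right≢middle : ∀ {e} → e ∈ₗ map right ups → e ∈ₗ middle → ⊥
      right≢middle p q with middle-zero q
      ... | refl = ℤₚ.<-irrefl refl (right-positive p)
      rest≥0 : ∀ {e} → e ∈ₗ map right ups ++ middle → 0ℤ ℤ.≤ e
      rest≥0 e∈ with ∈-++⁻ (map right ups) e∈
      ... | inj₁ p = ℤₚ.<⇒≤ (right-positive p)
      ... | inj₂ p = ℤₚ.≤-reflexive (sym (middle-zero p))
      left≢rest : ∀ {e} → e ∈ₗ map left ups → e ∈ₗ map right ups ++ middle → ⊥
      left≢rest p q with ∈-map⁻ left p
      ... | _ , j∈ , refl = ℤₚ.<⇒≱ (left<0 (proj₁ (∈-ups⁻ j∈))) (rest≥0 q)

    column-bound : ∀ {e} → Column e → ∣ e ∣ ≤ r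
    column-bound (leftColumn {j} j∈) =
      subst (_≤ r) (trans (cong ∣_∣ (sym (-left j))) (ℤₚ.∣-i∣≡∣i∣ (left j))) (∣right∣ (ℕₚ.<⇒≤ (proj₁ (∈-ups⁻ j∈))))
    column-bound (rightColumn j∈) = ∣right∣ (ℕₚ.<⇒≤ (proj₁ (∈-ups⁻ j∈)))
    column-bound (middleColumn _) = z≤n

    column-removable : ∀ {e} → Column e → ∃ λ k → Removable (w ℤ.* k ℤ.+ e)
    column-removable (leftColumn {j} j∈)  = f (suc j) , ups-removable j∈
    column-removable (rightColumn {j} j∈) = ℤ.- f (suc j) ,
      subst (λ e → Removable (w ℤ.* (ℤ.- f (suc j)) ℤ.+ e)) (-left j)
        (Removable-flip (f (suc j)) (left j) (ups-removable j∈))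
    column-removable (middleColumn fr) = 0ℤ , subst Removable (eq w) removable-0
      where
      eq : ∀ w → 0ℤ ≡ w ℤ.* 0ℤ ℤ.+ 0ℤ
      eq = solve-∀
      removable-0 : Removable 0ℤ
      removable-0 with last-cases
      ... | inj₁ (b , _) = b , exclusive b
      ... | inj₂ (_ , fr′ , _) = contradiction (trans (sym fr) fr′) λ ()

    private
      -- If f(r) were 0, then w k - 1, a place of column r missing from `B`, would force k ≥ 1. The
      -- negative of w k is removable too and would force -k ≥ 1.
      removable-middle : ∀ {k} → Removable (w ℤ.* k ℤ.+ 0ℤ) → f r ≡ -1ℤ
      removable-middle {k} p with last-cases
      ... | inj₁ (_ , fr , _) = fr
      ... | inj₂ (_ , fr , _) = ⊥-elim (absurd₂ (below {k} p) (below {ℤ.- k} p′) 1 (eq k))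
        where
        below : ∀ {k} → Removable (w ℤ.* k ℤ.+ 0ℤ) → 1ℤ ℤ.≤ k
        below {k} (_ , ¬b) = suc≤ (ℤₚ.≰⇒> λ k≤0 →
          ¬b (subst B (eq w k (+ r)) (to (top ℕₚ.≤-refl k) (subst (k ℤ.≤_) (sym fr) k≤0))))
          where
          eq : ∀ w k r → w ℤ.* k ℤ.+ (r ℤ.- (1ℤ ℤ.+ r)) ≡ w ℤ.* k ℤ.+ 0ℤ ℤ.- 1ℤ
          eq = solve-∀
        p′ : Removable (w ℤ.* (ℤ.- k) ℤ.+ 0ℤ)
        p′ = Removable-flip k 0ℤ p
        eq : ∀ k → k ℤ.- 1ℤ ℤ.+ (ℤ.- k ℤ.- 1ℤ) ≡ -[1+ 1 ]
        eq = solve-∀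

      -- When s is odd, the residue r + 1 is that of column 0 and its own mirror image.
      residue-r+1-not-removable : ∀ {k} → + s ≡ 1ℤ ℤ.+ (+ r ℤ.+ + r) → ¬ Removable (w ℤ.* k ℤ.+ (1ℤ ℤ.+ + r))
      residue-r+1-not-removable {k} s≡ p = absurd₂ (above {k} p) (above { -1ℤ ℤ.- k} p′) 0 (eq k)
        where
        lem : ∀ s r k → s ≡ 1ℤ ℤ.+ (r ℤ.+ r) →
              (1ℤ ℤ.+ s) ℤ.* k ℤ.+ (1ℤ ℤ.+ r) ≡ (1ℤ ℤ.+ s) ℤ.* (1ℤ ℤ.+ k) ℤ.+ (0ℤ ℤ.- (1ℤ ℤ.+ r))
        lem _ r k refl = eq r k
          where
          eq : ∀ r k → (1ℤ ℤ.+ (1ℤ ℤ.+ (r ℤ.+ r))) ℤ.* k ℤ.+ (1ℤ ℤ.+ r) ≡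
                       (1ℤ ℤ.+ (1ℤ ℤ.+ (r ℤ.+ r))) ℤ.* (1ℤ ℤ.+ k) ℤ.+ (0ℤ ℤ.- (1ℤ ℤ.+ r))
          eq = solve-∀
        lem′ : ∀ s r k → s ≡ 1ℤ ℤ.+ (r ℤ.+ r) →
               (1ℤ ℤ.+ s) ℤ.* (ℤ.- k) ℤ.+ ℤ.- (1ℤ ℤ.+ r) ≡ (1ℤ ℤ.+ s) ℤ.* (-1ℤ ℤ.- k) ℤ.+ (1ℤ ℤ.+ r)
        lem′ _ r k refl = eq r k
          where
          eq : ∀ r k → (1ℤ ℤ.+ (1ℤ ℤ.+ (r ℤ.+ r))) ℤ.* (ℤ.- k) ℤ.+ ℤ.- (1ℤ ℤ.+ r) ≡
                       (1ℤ ℤ.+ (1ℤ ℤ.+ (r ℤ.+ r))) ℤ.* (-1ℤ ℤ.- k) ℤ.+ (1ℤ ℤ.+ r)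
          eq = solve-∀
        above : ∀ {k} → Removable (w ℤ.* k ℤ.+ (1ℤ ℤ.+ + r)) → 1ℤ ℤ.+ k ℤ.≤ 0ℤ
        above {k} (b , _) = subst (1ℤ ℤ.+ k ℤ.≤_) f-first
          (from (top z≤n (1ℤ ℤ.+ k)) (subst B (lem (+ s) (+ r) k s≡) b))
        p′ : Removable (w ℤ.* (-1ℤ ℤ.- k) ℤ.+ (1ℤ ℤ.+ + r))
        p′ = subst Removable (lem′ (+ s) (+ r) k s≡) (Removable-flip k (1ℤ ℤ.+ + r) p)
        eq : ∀ k → 0ℤ ℤ.- (1ℤ ℤ.+ k) ℤ.+ (0ℤ ℤ.- (1ℤ ℤ.+ (-1ℤ ℤ.- k))) ≡ -[1+ 0 ]
        eq = solve-∀

    -- Let a be the residue of n + r modulo s + 1, so the offset is a - r. It is a left residue for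
    -- a < r and the middle one for a = r. For r < a ≤ 2 r the negative of n falls under the left
    -- residue of 2 r - a. The value a = 2 r + 1 occurs for odd s only and is excluded separately.
    removable-column : ∀ {n} → Removable n → ∃ λ e → Column e × ∃ λ k → n ≡ w ℤ.* k ℤ.+ e
    removable-column {n} p = go (ℕₚ.<-cmp a r)
      where
      a : ℕ
      a = (n ℤ.+ + r) %ℕ suc s
      k : ℤ
      k = (n ℤ.+ + r) /ℕ suc s
      a≤s : a ≤ s
      a≤s = ℕₚ.≤-pred (n%ℕd<d (n ℤ.+ + r) (suc s))
      eq : ∀ n r → n ≡ n ℤ.+ r ℤ.- r
      eq = solve-∀
      eq′ : ∀ w a k r → a ℤ.+ k ℤ.* w ℤ.- r ≡ w ℤ.* k ℤ.+ (a ℤ.- r)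
      eq′ = solve-∀
      n≡ : n ≡ w ℤ.* k ℤ.+ (+ a ℤ.- + r)
      n≡ = trans (eq n (+ r)) (trans (cong (ℤ._- + r) (a≡a%ℕn+[a/ℕn]*n (n ℤ.+ + r) (suc s))) (eq′ w (+ a) k (+ r)))
      p′ : Removable (w ℤ.* k ℤ.+ (+ a ℤ.- + r))
      p′ = subst Removable n≡ p
      beyond : r < a → ∃ λ e → Column e × ∃ λ k → n ≡ w ℤ.* k ℤ.+ e
      beyond r<a with a ℕₚ.≤? r ℕ.+ r
      ... | yes a≤2r = right j , rightColumn (removable-ups {k = ℤ.- k} j<r
                (subst (λ e → Removable (w ℤ.* (ℤ.- k) ℤ.+ e)) -e≡ (Removable-flip k (+ a ℤ.- + r) p′))) ,
              k , trans n≡ (cong (λ e → w ℤ.* k ℤ.+ e) e≡)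
        where
        j : ℕ
        j = r ℕ.+ r ∸ a
        j+a : + j ℤ.+ + a ≡ + r ℤ.+ + r
        j+a = cong +_ (ℕₚ.m∸n+n≡m a≤2r)
        lem : ∀ j a r → j ℤ.+ a ≡ r ℤ.+ r → a ℤ.- r ≡ r ℤ.- j
        lem j a r q = trans (sum-eq j a r) (trans (cong (ℤ._- (j ℤ.+ r)) q) (sum-eq′ j r))
          where
          sum-eq : ∀ j a r → a ℤ.- r ≡ j ℤ.+ a ℤ.- (j ℤ.+ r)
          sum-eq = solve-∀
          sum-eq′ : ∀ j r → r ℤ.+ r ℤ.- (j ℤ.+ r) ≡ r ℤ.- j
          sum-eq′ = solve-∀
        e≡ : + a ℤ.- + r ≡ right j
        e≡ = lem (+ j) (+ a) (+ r) j+a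
        -e≡ : ℤ.- (+ a ℤ.- + r) ≡ left j
        -e≡ = trans (cong ℤ.-_ (trans e≡ (sym (-left j)))) (ℤₚ.neg-involutive (left j))
        j<r : j < r
        j<r = ℕₚ.+-cancelʳ-< a j r (subst (ℕ._< r ℕ.+ a) (sym (ℕₚ.m∸n+n≡m a≤2r)) (ℕₚ.+-monoʳ-< r r<a))
      ... | no a≰2r with half-parity s
      ...   | inj₁ e = contradiction (subst (a ≤_) e a≤s) a≰2r
      ...   | inj₂ e = contradiction (subst (λ e → Removable (w ℤ.* k ℤ.+ e)) e≡ p′) (residue-r+1-not-removable {k} (cong +_ e))
        where
        a≡ : a ≡ suc (r ℕ.+ r)
        a≡ = ℕₚ.≤-antisym (subst (a ≤_) e a≤s) (ℕₚ.≰⇒> a≰2r)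
        eq″ : ∀ r → 1ℤ ℤ.+ (r ℤ.+ r) ℤ.- r ≡ 1ℤ ℤ.+ r
        eq″ = solve-∀
        e≡ : + a ℤ.- + r ≡ 1ℤ ℤ.+ + r
        e≡ = trans (cong (λ x → + x ℤ.- + r) a≡) (eq″ (+ r))
      go : _ → ∃ λ e → Column e × ∃ λ k → n ≡ w ℤ.* k ℤ.+ e
      go (tri< a<r _ _) = left a , leftColumn (removable-ups {k = k} a<r p′) , k , n≡
      go (tri≈ _ a≡r _) = 0ℤ , middleColumn (removable-middle {k} (subst (λ e → Removable (w ℤ.* k ℤ.+ e)) e≡0 p′)) ,
          k , trans n≡ (cong (λ e → w ℤ.* k ℤ.+ e) e≡0)
        where
        e≡0 : + a ℤ.- + r ≡ 0ℤ
        e≡0 = ℤₚ.i≡j⇒i-j≡0 {+ a} {+ r} (cong +_ a≡r)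
      go (tri> _ _ r<a) = beyond r<a

    private
      column-unique′ : ∀ {e e′ n} → Column e × (∃ λ k → n ≡ w ℤ.* k ℤ.+ e) → Column e′ × (∃ λ k → n ≡ w ℤ.* k ℤ.+ e′) → e ≡ e′
      column-unique′ {e} {e′} (c , k , eq) (c′ , k′ , eq′) =
        column-unique {k} {k′} {e} {e′} (column-bound c) (column-bound c′) (trans (sym eq) eq′)

      removable-unique′ : ∀ {e n n′} → Removable n → Removable n′ →
                          (∃ λ k → n ≡ w ℤ.* k ℤ.+ e) → (∃ λ k → n′ ≡ w ℤ.* k ℤ.+ e) → n ≡ n′
      removable-unique′ {e} p p′ (k , eq) (k′ , eq′) = trans eq (trans (cong (λ x → w ℤ.* x ℤ.+ e)
        (Removable-unique {k} {k′} {e} (subst Removable eq p) (subst Removable eq′ p′))) (sym eq′))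

    -- List elements and residues are matched through a common removable place. A residue class has
    -- only one such place and a place only one residue in range, so the matching is injective both
    -- ways and the pigeonhole bound applies twice.
    removable-count : {A : Set} (S : A → ℤ → Set) →
      (∀ {x n n′} → S x n → S x n′ → n ≡ n′) → (∀ {x x′ n} → S x n → S x′ n → x ≡ x′) →
      ∀ {xs} → Unique xs →
      (∀ {x} → x ∈ₗ xs → ∃ λ n → Removable n × S x n) →
      (∀ {n} → Removable n → ∃ λ x → x ∈ₗ xs × S x n) →
      length xs ≡ length columns
    removable-count {A} S unique-n unique-x xs-! forth back = ℕₚ.≤-antisym
      (length-≤ R R-unique-x xs-! λ x∈ →
        let n , p , Sxn       = forth x∈
            e , c , k , eq    = removable-column p
        in e , ∈-columns⁺ c , n , p , Sxn , c , k , eq)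
      (length-≤ (λ e x → R x e) R-unique-e columns-! λ e∈ →
        let c         = ∈-columns⁻ e∈
            k , p     = column-removable c
            x , x∈ , Sxn = back p
        in x , x∈ , _ , p , Sxn , c , k , refl)
      where
      R : A → ℤ → Set
      R x e = ∃ λ n → Removable n × S x n × Column e × ∃ λ k → n ≡ w ℤ.* k ℤ.+ e
      R-unique-x : ∀ {x x′ e} → R x e → R x′ e → x ≡ x′
      R-unique-x {e = e} (n , p , Sxn , _ , eq) (n′ , p′ , Sx′n′ , _ , eq′) =
        unique-x Sxn (subst (S _) (sym (removable-unique′ {e} p p′ eq eq′)) Sx′n′)
      R-unique-e : ∀ {e e′ x} → R x e → R x e′ → e ≡ e′
      R-unique-e {e} {e′} (n , _ , Sxn , c , eq) (n′ , _ , Sxn′ , c′ , (k′ , eq′)) =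
        column-unique′ {e} {e′} {n} (c , eq) (c′ , k′ , trans (unique-n Sxn Sxn′) eq′)

    -- Flat steps, last step and number of residues.

    path : Path (suc r)
    path = tabulate λ k → f (suc (toℕ k)) ℤ.- f (toℕ k)

    path-steps : VecAll.All (λ d → d ≡ U ⊎ d ≡ D ⊎ d ≡ F) path
    path-steps = VecAllₚ.tabulate⁺ λ k → step (ℕₚ.≤-pred (Finₚ.toℕ<n k))

    path-height : height path ≡ -1ℤ
    path-height = trans (height-tabulate f (suc r)) (cong₂ ℤ._-_ f-last f-first)

    u : ℕ
    u = length ups

    path-flats : + flats path ≡ + r ℤ.- + (u ℕ.+ u)
    path-flats = trans (flats-height path-steps) (trans
      (cong₂ (λ h x → + suc r ℤ.+ h ℤ.- + (x ℕ.+ x)) path-height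
        (count-tabulate (ℤₚ._≟ U) (λ k → f (suc k) ℤ.- f k) id (suc r)))
      (eq (+ r) (+ (u ℕ.+ u))))
      where
      eq : ∀ r x → 1ℤ ℤ.+ r ℤ.+ -1ℤ ℤ.- x ≡ r ℤ.- x
      eq = solve-∀

    private
      length-columns : length columns ≡ u ℕ.+ (u ℕ.+ length middle)
      length-columns = trans (Listₚ.length-++ (map left ups)) (cong₂ ℕ._+_ (Listₚ.length-map left ups)
        (trans (Listₚ.length-++ (map right ups)) (cong (ℕ._+ length middle) (Listₚ.length-map right ups))))

      length-middle-flat : f r ≡ -1ℤ → length middle ≡ 1
      length-middle-flat e = cong length (Listₚ.filter-accept middle? {x = 0ℤ} {xs = []} e)

      length-middle-down : f r ≡ 0ℤ → length middle ≡ 0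
      length-middle-down e = cong length (Listₚ.filter-reject middle? {x = 0ℤ} {xs = []} λ e′ →
        contradiction (trans (sym e) e′) λ ())

      path-last : last path ≡ last-step
      path-last = last-tabulate (λ k → f (suc k) ℤ.- f k) r

    path-end : (last path ≡ D × length columns ≡ u ℕ.+ u) ⊎ (last path ≡ F × length columns ≡ suc (u ℕ.+ u))
    path-end = Sum.[ (λ (_ , e , flat) → inj₂ (trans path-last flat ,
                       trans length-columns (trans (cong (λ x → u ℕ.+ (u ℕ.+ x)) (length-middle-flat e)) (eq u))))
                   , (λ (_ , e , down) → inj₁ (trans path-last down ,
                       trans length-columns (trans (cong (λ x → u ℕ.+ (u ℕ.+ x)) (length-middle-down e))
                                                   (cong (u ℕ.+_) (ℕₚ.+-identityʳ u)))))
                   ]′ last-cases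
      where
      eq : ∀ u → u ℕ.+ (u ℕ.+ 1) ≡ suc (u ℕ.+ u)
      eq u = trans (sym (ℕₚ.+-assoc u u 1)) (ℕₚ.+-comm (u ℕ.+ u) 1)

-- The path of a self-conjugate core.

SelfConjugateCores : ℕ → Pred Partition 0ℓ
SelfConjugateCores s μ = SelfConjugate μ × IsCore s μ × IsCore (suc s) μ × IsCore (suc (suc s)) μ

SC⇒SelfConjugateCores : ∀ {s p} μ → 2 ≤ p → SC (interval s p) μ → SelfConjugateCores s μ
SC⇒SelfConjugateCores {s} μ (s≤s (s≤s _)) (sc , c₀ ∷ c₁ ∷ c₂ ∷ _) =
  sc , subst (λ t → IsCore t μ) (ℕₚ.+-identityʳ s) c₀ , subst (λ t → IsCore t μ) (ℕₚ.+-comm s 1) c₁ ,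
  subst (λ t → IsCore t μ) (ℕₚ.+-comm s 2) c₂

module CorePath {s : ℕ} (1≤s : 1 ≤ s) (μ : Partition) (σ : SelfConjugateCores s μ) where

  coreDiagram : CoreDiagram s (Maya μ)
  coreDiagram = let sc , core₀ , core₁ , core₂ = σ in record
    { exclusive = SelfConj.Maya-exclusive μ sc
    ; total     = SelfConj.Maya-total μ sc
    ; closed₀   = SelfConj.core-closed μ sc core₀ 1≤s
    ; closed₁   = SelfConj.core-closed μ sc core₁ (s≤s z≤n)
    ; closed₂   = SelfConj.core-closed μ sc core₂ (s≤s z≤n)
    }

  -- Closure under s + 1 fills each column below its top, so the greatest row alone determines the
  -- column.
  abacus-top : ∀ {j} → j ≤ ⌊ s /2⌋ → ∀ k → k ℤ.≤ abacusFunction s μ j ⇔ Maya μ (place s k j)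
  abacus-top {j} j≤r k = mk⇔
    (λ k≤ → Diagram.closed-below coreDiagram {abacusFunction s μ j} {k} {+ j ℤ.- + suc ⌊ s /2⌋} k≤
              (SelfConj.top-Maya μ (proj₁ σ) s {j} {abacusFunction s μ j} v))
    (SelfConj.top-max μ (proj₁ σ) s {j} {abacusFunction s μ j} v k)
    where
    v : IsAbacusValue s μ j (abacusFunction s μ j)
    v = abacusFunction-value s μ j≤r

  abacus-first : abacusFunction s μ 0 ≡ 0ℤ
  abacus-first = f-first coreDiagram (abacusFunction s μ) abacus-top (abacusFunction-last s μ)
    where open Diagram.AbacusFunction

  φ-∈-𝓕 : 𝓕 (suc ⌊ s /2⌋) -1ℤ (φ s μ)
  φ-∈-𝓕 = path-steps coreDiagram (abacusFunction s μ) abacus-top (abacusFunction-last s μ) ,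
           path-height coreDiagram (abacusFunction s μ) abacus-top (abacusFunction-last s μ)
    where open Diagram.AbacusFunction

  private
    -- Links a part size with the place of the last row of that length; it serves as `S` in
    -- `removable-count`.
    Corner : ℕ → ℤ → Set
    Corner d n = ∃ λ i → row μ i ≡ d × row μ (suc i) < row μ i × position μ i ≡ n

    corner-place-unique : ∀ {d n n′} → Corner d n → Corner d n′ → n ≡ n′
    corner-place-unique (i , e , q , eq) (i′ , e′ , q′ , eq′) =
      trans (sym eq) (trans (cong (position μ) (corner-row-unique μ q q′ (trans e (sym e′)))) eq′)

    corner-part-unique : ∀ {d d′ n} → Corner d n → Corner d′ n → d ≡ d′
    corner-part-unique (i , e , _ , eq) (i′ , e′ , _ , eq′) =
      trans (sym e) (trans (cong (row μ) (position-injective μ (trans eq (sym eq′)))) e′)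

    part⇒removable : ∀ {d} → d ∈ₗ deduplicate ℕₚ._≟_ (parts μ) → ∃ λ n → Diagram.Removable coreDiagram n × Corner d n
    part⇒removable d∈ =
      let i , e , q = last-occurrence (nonIncreasing μ) (Defs.positive μ) (∈-deduplicate⁻ ℕₚ._≟_ (parts μ) d∈)
      in position μ i , ((i , refl) , corner-removable μ q) , i , e , q , refl

    removable⇒part : ∀ {n} → Diagram.Removable coreDiagram n → ∃ λ d → d ∈ₗ deduplicate ℕₚ._≟_ (parts μ) × Corner d n
    removable⇒part ((i , eq) , ¬b) =
      let q = removable-corner μ λ b → ¬b (subst (λ n → Maya μ (n ℤ.- 1ℤ)) eq b)
      in row μ i , ∈-deduplicate⁺ ℕₚ._≟_ (entry-∈ (parts μ) i (ℕₚ.≤-<-trans z≤n q)) , i , refl , q , eq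

    corners≡columns :
      corners μ ≡ length (Diagram.AbacusFunction.columns coreDiagram (abacusFunction s μ) abacus-top (abacusFunction-last s μ))
    corners≡columns = Diagram.AbacusFunction.removable-count coreDiagram (abacusFunction s μ) abacus-top (abacusFunction-last s μ)
      Corner corner-place-unique corner-part-unique (deduplicate-! (parts μ)) part⇒removable removable⇒part

  -- The number u is the number of up steps.
  φ-statistics : ∃ λ u → + flats (φ s μ) ≡ + ⌊ s /2⌋ ℤ.- + (u ℕ.+ u) ×
    ((last (φ s μ) ≡ D × corners μ ≡ u ℕ.+ u) ⊎ (last (φ s μ) ≡ F × corners μ ≡ suc (u ℕ.+ u)))
  φ-statistics = u coreDiagram (abacusFunction s μ) abacus-top (abacusFunction-last s μ) ,
    path-flats coreDiagram (abacusFunction s μ) abacus-top (abacusFunction-last s μ) ,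
    Sum.map (λ (l , c) → l , trans corners≡columns c) (λ (l , c) → l , trans corners≡columns c)
      (path-end coreDiagram (abacusFunction s μ) abacus-top (abacusFunction-last s μ))
    where open Diagram.AbacusFunction

-- Injectivity of φ on cores.

module _ {s : ℕ} (1≤s : 1 ≤ s) where

  open CorePath 1≤s

  private
    -- If n lies in a column, equal tops settle the claim. If only its mirror image does and n were
    -- missing from `ν`, the mirror image would be in `ν`, hence by equal tops in `μ`, next to n.
    Maya-⊆ : ∀ μ ν → SelfConjugateCores s μ → SelfConjugateCores s ν →
             (∀ j → j ≤ ⌊ s /2⌋ → abacusFunction s μ j ≡ abacusFunction s ν j) →
             ∀ {n} → Maya μ n → Maya ν n
    Maya-⊆ μ ν σ τ e {n} b = Sum.[ direct , mirrored ]′ (place-or-mirror s n)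
      where
      direct : (∃ λ k → ∃ λ j → j ≤ ⌊ s /2⌋ × n ≡ place s k j) → Maya ν n
      direct (k , j , j≤r , n≡) = subst (Maya ν) (sym n≡) (to (abacus-top ν τ j≤r k)
        (subst (k ℤ.≤_) (e j j≤r) (from (abacus-top μ σ j≤r k) (subst (Maya μ) n≡ b))))
      mirrored : (∃ λ k → ∃ λ j → j ≤ ⌊ s /2⌋ × -1ℤ ℤ.- n ≡ place s k j) → Maya ν n
      mirrored (k , j , j≤r , n≡) = Sum.[ id , (λ b′ → ⊥-elim (SelfConj.Maya-exclusive μ (proj₁ σ) {n} b (reflected b′))) ]′
        (SelfConj.Maya-total ν (proj₁ τ) n)
        where
        reflected : Maya ν (-1ℤ ℤ.- n) → Maya μ (-1ℤ ℤ.- n)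
        reflected b′ = subst (Maya μ) (sym n≡) (to (abacus-top μ σ j≤r k)
          (subst (k ℤ.≤_) (sym (e j j≤r)) (from (abacus-top ν τ j≤r k) (subst (Maya ν) n≡ b′))))

  φ-injective : ∀ μ ν → SelfConjugateCores s μ → SelfConjugateCores s ν → φ s μ ≡ φ s ν → μ ≡ ν
  φ-injective μ ν σ τ e = Maya-injective λ {n} →
    mk⇔ (Maya-⊆ μ ν σ τ same {n}) (Maya-⊆ ν μ τ σ (λ j j≤r → sym (same j j≤r)) {n})
    where
    same : ∀ j → j ≤ ⌊ s /2⌋ → abacusFunction s μ j ≡ abacusFunction s ν j
    -- Both functions start at 0, so the steps of the path determine them.
    same j j≤r = differences-injective (suc ⌊ s /2⌋) {abacusFunction s μ} {abacusFunction s ν}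
      (trans (abacus-first μ σ) (sym (abacus-first ν τ))) e j (ℕₚ.m≤n⇒m≤1+n j≤r)

-- Parity of the number of corners, and the bijections.

2∣u+u : ∀ u → 2 ∣ u ℕ.+ u
2∣u+u u = divides u (trans (cong (u ℕ.+_) (sym (ℕₚ.+-identityʳ u))) (ℕₚ.*-comm 2 u))

2∤1+u+u : ∀ u → 2 ∤ suc (u ℕ.+ u)
2∤1+u+u u d with ∣1⇒≡1 (∣m+n∣m⇒∣n (subst (2 ∣_) (ℕₚ.+-comm 1 (u ℕ.+ u)) d) (2∣u+u u))
... | ()

theorem3p8 : (s p : ℕ) → 1 ≤ s → 2 ≤ p → (m : ℕ) →
    (2 ∣ m →
    BijectionBetween (φ s)
    (λ μ → μ ∈ SC (interval s p) × corners μ ≡ m)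
    (λ P → P ∈ 𝐅[ D ] s p × + flats P ≡ + ⌊ s /2⌋ ℤ.- + m))
    × (2 ∤ m →
    BijectionBetween (φ s)
    (λ μ → μ ∈ SC (interval s p) × corners μ ≡ m)
    (λ P → P ∈ 𝐅[ F ] s p × + flats P ≡ + ⌊ s /2⌋ ℤ.- + m ℤ.+ 1ℤ))
theorem3p8 s p 1≤s 2≤p m =
  (λ 2∣m → even-maps-to 2∣m , injective , even-onto) ,
  (λ 2∤m → odd-maps-to 2∤m , injective , odd-onto)
  where
  core : ∀ μ → μ ∈ SC (interval s p) → SelfConjugateCores s μ
  core μ = SC⇒SelfConjugateCores μ 2≤p

  injective : ∀ μ ν → μ ∈ SC (interval s p) × corners μ ≡ m → ν ∈ SC (interval s p) × corners ν ≡ m →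
              φ s μ ≡ φ s ν → μ ≡ ν
  injective μ ν (μ∈ , _) (ν∈ , _) = φ-injective 1≤s μ ν (core μ μ∈) (core ν ν∈)

  D≢F : D ≢ F
  D≢F ()

  shift : ∀ r x → r ℤ.- x ≡ r ℤ.- (1ℤ ℤ.+ x) ℤ.+ 1ℤ
  shift = solve-∀

  same-offset : ∀ {x} → + ⌊ s /2⌋ ℤ.- + x ≡ + ⌊ s /2⌋ ℤ.- + m → x ≡ m
  same-offset {x} e = ℤₚ.+-injective (ℤₚ.neg-injective (∙-cancelˡ (+ ⌊ s /2⌋) (ℤ.- (+ x)) (ℤ.- (+ m)) e))

  even-maps-to : 2 ∣ m → ∀ μ → μ ∈ SC (interval s p) × corners μ ≡ m →
                 φ s μ ∈ 𝐅[ D ] s p × + flats (φ s μ) ≡ + ⌊ s /2⌋ ℤ.- + m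
  even-maps-to 2∣m μ (μ∈ , m≡) =
    let u , flats≡ , end = CorePath.φ-statistics 1≤s μ (core μ μ∈) in
    Sum.[ (λ (last≡D , c) →
            ((CorePath.φ-∈-𝓕 1≤s μ (core μ μ∈) , μ , μ∈ , refl) , last≡D) ,
            trans flats≡ (cong (λ x → + ⌊ s /2⌋ ℤ.- + x) (trans (sym c) m≡)))
        , (λ (_ , c) → ⊥-elim (2∤1+u+u u (subst (2 ∣_) (trans (sym m≡) c) 2∣m)))
        ]′ end

  odd-maps-to : 2 ∤ m → ∀ μ → μ ∈ SC (interval s p) × corners μ ≡ m →
                φ s μ ∈ 𝐅[ F ] s p × + flats (φ s μ) ≡ + ⌊ s /2⌋ ℤ.- + m ℤ.+ 1ℤ
  odd-maps-to 2∤m μ (μ∈ , m≡) =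
    let u , flats≡ , end = CorePath.φ-statistics 1≤s μ (core μ μ∈) in
    Sum.[ (λ (_ , c) → ⊥-elim (2∤m (subst (2 ∣_) (trans (sym c) m≡) (2∣u+u u))))
        , (λ (last≡F , c) →
            ((CorePath.φ-∈-𝓕 1≤s μ (core μ μ∈) , μ , μ∈ , refl) , last≡F) ,
            -- Here m = 2 u + 1, so r - 2 u is rewritten as r - m + 1.
            trans flats≡ (trans (shift (+ ⌊ s /2⌋) (+ (u ℕ.+ u)))
              (cong (λ x → + ⌊ s /2⌋ ℤ.- + x ℤ.+ 1ℤ) (trans (sym c) m≡))))
        ]′ end

  -- Membership in `𝐅` supplies a preimage; only its number of corners has to be recovered, from the
  -- last step and the number of flat steps.
  even-onto : ∀ P → P ∈ 𝐅[ D ] s p × + flats P ≡ + ⌊ s /2⌋ ℤ.- + m →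
              ∃ λ μ → (μ ∈ SC (interval s p) × corners μ ≡ m) × φ s μ ≡ P
  even-onto P (((_ , μ , μ∈ , φμ≡P) , last≡D) , flats≡m) = μ , (μ∈ , corners≡m) , φμ≡P
    where
    corners≡m : corners μ ≡ m
    corners≡m =
      let u , flats≡ , end = CorePath.φ-statistics 1≤s μ (core μ μ∈) in
      Sum.[ (λ (_ , c) → trans c (same-offset (trans (sym flats≡) (trans (cong (λ Q → + flats Q) φμ≡P) flats≡m))))
          , (λ (last≡F , _) → ⊥-elim (D≢F (trans (sym last≡D) (trans (cong last (sym φμ≡P)) last≡F))))
          ]′ end

  odd-onto : ∀ P → P ∈ 𝐅[ F ] s p × + flats P ≡ + ⌊ s /2⌋ ℤ.- + m ℤ.+ 1ℤ →
             ∃ λ μ → (μ ∈ SC (interval s p) × corners μ ≡ m) × φ s μ ≡ P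
  odd-onto P (((_ , μ , μ∈ , φμ≡P) , last≡F) , flats≡m) = μ , (μ∈ , corners≡m) , φμ≡P
    where
    corners≡m : corners μ ≡ m
    corners≡m =
      let u , flats≡ , end = CorePath.φ-statistics 1≤s μ (core μ μ∈) in
      Sum.[ (λ (last≡D , _) → ⊥-elim (D≢F (trans (sym last≡D) (trans (cong last φμ≡P) last≡F))))
          , (λ (_ , c) → trans c (same-offset (∙-cancelʳ 1ℤ _ _ (trans (sym (shift (+ ⌊ s /2⌋) (+ (u ℕ.+ u))))
              (trans (sym flats≡) (trans (cong (λ Q → + flats Q) φμ≡P) flats≡m))))))
          ]′ end
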